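{- Assume Zaremba's conjecture: there is a constant $m$ such that for every integer $q\ge 1$ there is an integer $p$ coprime to $q$ such that $$\frac{p}{q}=[a_0,a_1,a_2,\dots]$$ (a finite continued fraction) with all the integers $a_i$ between $1$ and $m$. Then there exists an integer $m'$ such that every real quadratic field $\mathbb{Q}[\sqrt{\delta}]$ contains infinitely many periodic continued fractions uniformly bounded by $m'$.
   Context: $[a_0,a_1,a_2,\dots]=a_0+1/(a_1+1/(a_2+\cdots))$. A periodic continued fraction is a real number $[\overline{a_1,\dots,a_p}]$ whose continued fraction expansion is purely periodic with period $(a_1,\dots,a_p)$, $a_i\ge 1$ integers; it is bounded by $m'$ if all its partial quotients $a_i$ satisfy $1\le a_i\le m'$. -}

module Defs where

open import Data.Integer.Base as ℤ using (ℤ; +_)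
open import Data.Integer.Coprimality using (Coprime)
open import Data.List.Base using (List; []; _∷_)
open import Data.List.Relation.Unary.All using (All)
open import Data.Nat.Base as ℕ using (ℕ; suc)
open import Data.Product.Base using (_×_; ∃; ∃-syntax)
open import Data.Rational.Base as ℚ using (ℚ; 0ℚ; 1ℚ; _/_; 1/_)
open import Data.Sum.Base using (_⊎_)
open import Function.Definitions using (Injective)
open import Relation.Binary.PropositionalEquality.Core using (_≡_; _≢_)
open import Relation.Unary using (Pred)
open import Level using (0ℓ)

fromℕ : ℕ → ℚ
fromℕ n = + n / 1

Between1And : ℕ → ℕ → Set
Between1And m a = 1 ℕ.≤ a × a ℕ.≤ m

-- r ≡[ a₀ ∷ … ∷ aₙ ∷ [] ]  says  r = a₀ + 1/(a₁ + 1/(⋯ + 1/aₙ)).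
data _≡[_] : ℚ → List ℕ → Set where
  last : ∀ a → fromℕ a ≡[ a ∷ [] ]
  cons : ∀ a {as r} .{{_ : ℚ.NonZero r}} →
         r ≡[ as ] → (fromℕ a ℚ.+ 1/ r) ≡[ a ∷ as ]

ZarembaConjecture : Set
ZarembaConjecture =
  ∃[ m ] ∀ (q : ℕ) .{{_ : ℕ.NonZero q}} →
    ∃[ p ] Coprime p (+ q) ×
    ∃[ as ] (p / q) ≡[ as ] × All (Between1And m) as

NonSquare : ℕ → Set
NonSquare δ = ∀ k → k ℕ.* k ≢ δ

-- For non-square δ this is the real quadratic field ℚ[√δ] ⊂ ℝ: since √δ is
-- irrational, each element is re + im √δ for a unique pair of rationals, and
-- propositional equality is equality of real numbers.
record ℚ[√_] (δ : ℕ) : Set where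
  constructor _+_√δ
  field
    re : ℚ
    im : ℚ

open ℚ[√_] public

module _ {δ : ℕ} where

  infixl 6 _-ᴷ_
  infixl 7 _*ᴷ_
  infix 4 _<ᴷ_ _≤ᴷ_

  natᴷ : ℕ → ℚ[√ δ ]
  natᴷ n = fromℕ n + 0ℚ √δ

  1ᴷ : ℚ[√ δ ]
  1ᴷ = 1ℚ + 0ℚ √δ

  _-ᴷ_ _*ᴷ_ : ℚ[√ δ ] → ℚ[√ δ ] → ℚ[√ δ ]
  (a + b √δ) -ᴷ (c + d √δ) = (a ℚ.- c) + (b ℚ.- d) √δ
  (a + b √δ) *ᴷ (c + d √δ) =
    (a ℚ.* c ℚ.+ fromℕ δ ℚ.* (b ℚ.* d)) + (a ℚ.* d ℚ.+ b ℚ.* c) √δ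

  -- The order inherited from ℝ, where √δ > 0: the sign of the real number
  -- a + b √δ is that of whichever of a and b √δ has the larger absolute value,
  -- and the two absolute values agree only for a = b = 0.
  Positiveᴷ : ℚ[√ δ ] → Set
  Positiveᴷ (a + b √δ) =
    (0ℚ ℚ.< a × fromℕ δ ℚ.* (b ℚ.* b) ℚ.< a ℚ.* a) ⊎
    (0ℚ ℚ.< b × a ℚ.* a ℚ.< fromℕ δ ℚ.* (b ℚ.* b))

  _<ᴷ_ _≤ᴷ_ : ℚ[√ δ ] → ℚ[√ δ ] → Set
  x <ᴷ y = Positiveᴷ (y -ᴷ x)
  x ≤ᴷ y = x <ᴷ y ⊎ x ≡ y

  -- The infinite continued fraction expansion x = [a₀, a₁, a₂, …], for x ≥ 0:
  -- with complete quotients ξ₀ = x and ξₙ₊₁ = 1/(ξₙ - aₙ), aₙ is the integer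
  -- part of ξₙ.  The complete quotients of x lie in every field containing x.
  record _HasExpansion_ (x : ℚ[√ δ ]) (a : ℕ → ℕ) : Set where
    field
      ξ       : ℕ → ℚ[√ δ ]
      ξ-zero  : ξ 0 ≡ x
      floor-≤ : ∀ n → natᴷ (a n) ≤ᴷ ξ n
      floor-< : ∀ n → ξ n <ᴷ natᴷ (suc (a n))
      ξ-suc   : ∀ n → (ξ n -ᴷ natᴷ (a n)) *ᴷ ξ (suc n) ≡ 1ᴷ

PurelyPeriodic : (ℕ → ℕ) → Set
PurelyPeriodic a = ∃[ p ] ℕ.NonZero p × (∀ n → a (p ℕ.+ n) ≡ a n)

PeriodicCFBoundedBy : ℕ → ∀ {δ} → ℚ[√ δ ] → Set
PeriodicCFBoundedBy m′ x =
  ∃[ a ] x HasExpansion a × PurelyPeriodic a × (∀ n → Between1And m′ (a n))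

InfinitelyMany : {A : Set} → Pred A 0ℓ → Set
InfinitelyMany {A} P =
  ∃ λ (f : ℕ → A) → Injective _≡_ _≡_ f × (∀ n → P (f n))

{-# OPTIONS --safe #-}

-- Let q² = 1 + δ v² be a solution of Pell's equation and let [0; a₁, …, aₙ] have denominator q.
-- Choose n odd, so that the product M of the matrices (a 1 ; 1 0) of the digits has determinant 1.
-- With U = (1 2 ; 0 1), the matrix − M U M⁻¹ U has trace 4 q² − 2, and the discriminant
-- (4 q² − 2)² − 4 = δ (4 q v)² of its fixed points lies in the square class of δ.  Up to
-- conjugation it is the matrix of a word in positive digits: essentially a₁, …, aₙ followed by
-- the same digits reversed.  So Zaremba's conjecture bounds the digits of the purely periodic
-- number (p + v √δ) / q, and distinct Pell solutions give distinct v / q.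

module Submission where

open import Defs
open import Data.Bool.Base using (if_then_else_)
open import Data.Fin.Base using (Fin; toℕ; fromℕ<; combine)
open import Data.Fin.Properties using (pigeonhole; combine-injective; fromℕ<-injective)
open import Data.Integer.Base as ℤ using (ℤ; +_; ∣_∣)
import Data.Integer.Coprimality as ℤ using (Coprime)
import Data.Integer.Properties as ℤ
import Data.Integer.Tactic.RingSolver as ℤ-Solver
open import Data.List.Base using (List; []; _∷_; _++_; _∷ʳ_; length; reverse; initLast; _∷ʳ′_)
import Data.List.Properties as List
open import Data.List.Relation.Unary.All as All using (All; []; _∷_)
import Data.List.Relation.Unary.All.Properties as All
open import Data.Nat.Base as ℕ using (ℕ; zero; suc; z≤n; s≤s)
import Data.Nat.Coprimality as ℕ using (Coprime; coprime-divisor; sym)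
import Data.Nat.Divisibility as ℕ
import Data.Nat.Properties as ℕ
import Data.Nat.Tactic.RingSolver as ℕ-Solver
open import Data.Product.Base using (_×_; _,_; ∃; ∃-syntax; ∃₂; proj₁; proj₂)
open import Data.Rational.Base as ℚ using (ℚ; 0ℚ; 1ℚ; toℚᵘ)
import Data.Rational.Properties as ℚ
import Data.Rational.Solver as ℚ-Solver
open import Data.Rational.Unnormalised.Base as ℚᵘ using (mkℚᵘ; *≡*; *<*)
import Data.Rational.Unnormalised.Properties as ℚᵘ
open import Data.Sum.Base using (_⊎_; inj₁; inj₂)
open import Relation.Binary.Definitions using (tri<; tri≈; tri>)
open import Relation.Binary.PropositionalEquality
open import Relation.Nullary using (Dec; does; yes; no; contradiction; ¬_)
open import Relation.Nullary.Decidable using (dec-true; dec-false)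

-- Write M z for [0; a₁, ..., aₙ, z]. A fixed point x of - M U M⁻¹ U satisfies x = [0; a₁, ..., aₙ,
-- 2 - [0; aₙ, ..., a₁, - (2 + x)]]: inverting M reverses the digits but introduces minus signs. The
-- rule α - 1/β = [α - 1, 1, β - 1], used at both signs, removes them and gives x + 1 = [1; a₁, ...,
-- aₙ, 1, 1, aₙ - 1, ..., a₁ - 1, 1, x + 1]. This is the origin of the extra 1s. The lowered digits
-- must stay positive, so both end digits have to be at least 2. An end digit 1 is therefore merged
-- into its neighbour, which may grow to m + 1; this is why the final bound is `suc m`. Merging
-- needs room, so only q > m + 2 is treated, which still leaves infinitely many Pell solutions. The
-- expansion is verified without limits: rotating the period conjugates its matrix, keeps the
-- discriminant, and turns the number into its next complete quotient, so that the floor conditions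
-- become inequalities between integers.

-- Pell's equation from the river of the form x² - δ y²

module Pell where
  open import Data.Integer.Base using (_+_; _-_; _*_; -_; _<_; _≤_)

  -- The binary quadratic form a x² + 2 b x y − c y²; valueᵢⱼ is its value at (i , j).
  record Form : Set where
    constructor form
    field
      a b c : ℤ

    value₁₁ : ℤ
    value₁₁ = a + (b + b) - c

    value₁₋₁ : ℤ
    value₁₋₁ = a - (b + b) - c

    discriminant : ℤ
    discriminant = b * b + a * c

  open Form

  OnRiver : Form → Set
  OnRiver f = + 0 < a f × + 0 < c f

  -- The walk along Conway's river of the form: substitute y ↦ x + y (stepˡ) or x ↦ x + y (stepʳ),
  -- whichever keeps the end coefficients a and − c of opposite signs.  The walk is reversible and
  -- stays among the finitely many such forms of given discriminant, hence returns to x² − δ y².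
  stepˡ stepʳ unstepˡ unstepʳ step unstep : Form → Form
  stepˡ f = form (value₁₁ f) (b f - c f) (c f)
  stepʳ f = form (a f) (a f + b f) (- value₁₁ f)
  unstepˡ f = form (value₁₋₁ f) (b f + c f) (c f)
  unstepʳ f = form (a f) (b f - a f) (- value₁₋₁ f)
  step f   = if does (+ 0 ℤ.<? value₁₁ f) then stepˡ f else stepʳ f
  unstep f = if does (+ 0 ℤ.<? value₁₋₁ f) then unstepˡ f else unstepʳ f

  step-cases : ∀ f → (+ 0 < value₁₁ f × step f ≡ stepˡ f) ⊎ (¬ + 0 < value₁₁ f × step f ≡ stepʳ f)
  step-cases f = cases (+ 0 ℤ.<? value₁₁ f)
    where
    cases : ∀ {P : Set} (P? : Dec P) → let f′ = if does P? then stepˡ f else stepʳ f in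
            (P × f′ ≡ stepˡ f) ⊎ (¬ P × f′ ≡ stepʳ f)
    cases (yes p) = inj₁ (p , refl)
    cases (no ¬p) = inj₂ (¬p , refl)

  form-≡ : ∀ {a a′ b b′ c c′} → a ≡ a′ → b ≡ b′ → c ≡ c′ → form a b c ≡ form a′ b′ c′
  form-≡ refl refl refl = refl

  -- The new form takes at (1 , -1) the value of the old one at (1 , 0), which is a > 0; after
  -- `stepʳ` it would be the old value - c < 0 instead. So this sign tells `unstep` which branch to
  -- undo.
  unstep-stepˡ : ∀ {f} → + 0 < a f → unstep (stepˡ f) ≡ f
  unstep-stepˡ {f} 0<a = trans
    (cong (if_then unstepˡ (stepˡ f) else unstepʳ (stepˡ f))
          (dec-true (+ 0 ℤ.<? value₁₋₁ (stepˡ f)) (subst (+ 0 <_) (sym value≡a) 0<a)))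
    (form-≡ value≡a (b-c+c (b f) (c f)) refl)
    where
    identity : ∀ a b c → a + (b + b) - c - ((b - c) + (b - c)) - c ≡ a
    identity = ℤ-Solver.solve-∀
    value≡a : value₁₋₁ (stepˡ f) ≡ a f
    value≡a = identity (a f) (b f) (c f)
    b-c+c : ∀ b c → b - c + c ≡ b
    b-c+c = ℤ-Solver.solve-∀

  unstep-stepʳ : ∀ {f} → + 0 < c f → unstep (stepʳ f) ≡ f
  unstep-stepʳ {f} 0<c = trans
    (cong (if_then unstepˡ (stepʳ f) else unstepʳ (stepʳ f))
          (dec-false (+ 0 ℤ.<? value₁₋₁ (stepʳ f)) 0≮value))
    (form-≡ refl (a+b-a (a f) (b f)) (trans (cong -_ value≡-c) (ℤ.neg-involutive (c f))))
    where
    identity : ∀ a b c → a - ((a + b) + (a + b)) - - (a + (b + b) - c) ≡ - c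
    identity = ℤ-Solver.solve-∀
    value≡-c : value₁₋₁ (stepʳ f) ≡ - c f
    value≡-c = identity (a f) (b f) (c f)
    0≮value : ¬ + 0 < value₁₋₁ (stepʳ f)
    0≮value 0<v = ℤ.<-asym (ℤ.neg-mono-< 0<c) (subst (+ 0 <_) value≡-c 0<v)
    a+b-a : ∀ a b → a + b - a ≡ b
    a+b-a = ℤ-Solver.solve-∀

  unstep-step : ∀ {f} → OnRiver f → unstep (step f) ≡ f
  unstep-step {f} (0<a , 0<c) with step-cases f
  ... | inj₁ (_ , eq) = trans (cong unstep eq) (unstep-stepˡ 0<a)
  ... | inj₂ (_ , eq) = trans (cong unstep eq) (unstep-stepʳ 0<c)

  step-discriminant : ∀ f → discriminant (step f) ≡ discriminant f
  step-discriminant f@(form a b c) with step-cases f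
  ... | inj₁ (_ , eq) = trans (cong discriminant eq) (identity a b c)
    where
    identity : ∀ a b c → (b - c) * (b - c) + (a + (b + b) - c) * c ≡ b * b + a * c
    identity = ℤ-Solver.solve-∀
  ... | inj₂ (_ , eq) = trans (cong discriminant eq) (identity a b c)
    where
    identity : ∀ a b c → (a + b) * (a + b) + a * (- (a + (b + b) - c)) ≡ b * b + a * c
    identity = ℤ-Solver.solve-∀

  0<i⇒+∣i∣≡i : ∀ {i} → + 0 < i → + ∣ i ∣ ≡ i
  0<i⇒+∣i∣≡i 0<i = ℤ.0≤i⇒+∣i∣≡i (ℤ.<⇒≤ 0<i)

  +∣i∣²≡i² : ∀ i → + (∣ i ∣ ℕ.* ∣ i ∣) ≡ i * i
  +∣i∣²≡i² (+ n)        = ℤ.pos-* n n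
  +∣i∣²≡i² (ℤ.-[1+ n ]) = refl

  n≤n*n : ∀ n → n ℕ.≤ n ℕ.* n
  n≤n*n zero    = z≤n
  n≤n*n (suc n) = ℕ.m≤m*n (suc n) (suc n)

  repetition : ∀ {n} (f : ℕ → Fin n) → ∃₂ λ i d → f i ≡ f (i ℕ.+ suc d)
  repetition f
    with i , j , i<j , eq ← pigeonhole (ℕ.n<1+n _) (λ i → f (toℕ i))
    with d , i+d≡j ← ℕ.m≤n⇒∃[o]m+o≡n i<j
    = toℕ i , d , trans eq (cong f (sym (trans (ℕ.+-suc (toℕ i) d) i+d≡j)))

  module _ {δ : ℕ} (δ-nonSquare : NonSquare δ) where

    OfDiscriminantδ : Form → Set
    OfDiscriminantδ f = OnRiver f × discriminant f ≡ + δ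

    -- Since (a + b)² = b² + a c + a · f(1 , 1), a zero value would make δ the square of a + b. So
    -- the river never meets a lake, and `step` always finds a strict sign.
    value₁₁≢0 : ∀ f → discriminant f ≡ + δ → value₁₁ f ≢ + 0
    value₁₁≢0 (form a b c) disc v≡0 = δ-nonSquare ∣ a + b ∣ (ℤ.+-injective (begin
      + (∣ a + b ∣ ℕ.* ∣ a + b ∣)            ≡⟨ +∣i∣²≡i² (a + b) ⟩
      (a + b) * (a + b)                      ≡⟨ square a b c ⟩
      b * b + a * c + a * (a + (b + b) - c)  ≡⟨ cong₂ (λ x y → x + a * y) disc v≡0 ⟩
      + δ + a * + 0                          ≡⟨ absorb a (+ δ) ⟩
      + δ                                    ∎))
      where
      open ≡-Reasoning
      square : ∀ a b c → (a + b) * (a + b) ≡ b * b + a * c + a * (a + (b + b) - c)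
      square = ℤ-Solver.solve-∀
      absorb : ∀ a d → d + a * + 0 ≡ d
      absorb = ℤ-Solver.solve-∀

    step-onRiver : ∀ {f} → OfDiscriminantδ f → OnRiver (step f)
    step-onRiver {f} ((0<a , 0<c) , disc) with step-cases f
    ... | inj₁ (0<v , eq) = subst OnRiver (sym eq) (0<v , 0<c)
    ... | inj₂ (0≮v , eq) = subst OnRiver (sym eq) (0<a , ℤ.neg-mono-< v<0)
      where
      v<0 : value₁₁ f < + 0
      v<0 = ℤ.≤∧≢⇒< (ℤ.≮⇒≥ 0≮v) (value₁₁≢0 f disc)

    orbit : ℕ → Form
    orbit zero    = form (+ 1) (+ 0) (+ δ)
    orbit (suc k) = step (orbit k)

    0<δ : 0 ℕ.< δ
    0<δ = ℕ.n≢0⇒n>0 (λ δ≡0 → δ-nonSquare 0 (sym δ≡0))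

    orbit-discriminant : ∀ k → OfDiscriminantδ (orbit k)
    orbit-discriminant zero    = (ℤ.+<+ (s≤s z≤n) , ℤ.+<+ 0<δ) , trans (ℤ.+-identityˡ _) (ℤ.*-identityˡ (+ δ))
    orbit-discriminant (suc k) =
      step-onRiver (orbit-discriminant k) ,
      trans (step-discriminant (orbit k)) (proj₂ (orbit-discriminant k))

    step-injective : ∀ {f g} → OnRiver f → OnRiver g → step f ≡ step g → f ≡ g
    step-injective {f} {g} rf rg eq =
      trans (sym (unstep-step rf)) (trans (cong unstep eq) (unstep-step rg))

    orbit-cancel : ∀ i d → orbit i ≡ orbit (i ℕ.+ d) → orbit 0 ≡ orbit d
    orbit-cancel zero    d eq = eq
    orbit-cancel (suc i) d eq = orbit-cancel i d
      (step-injective (proj₁ (orbit-discriminant i)) (proj₁ (orbit-discriminant (i ℕ.+ d))) eq)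

    -- On the river b² + a c = δ is a sum of two nonnegative terms, and a, c ≥ 1.
    bounded : ∀ {f} → OfDiscriminantδ f → ∣ a f ∣ ℕ.≤ δ × ∣ b f ∣ ℕ.≤ δ × ∣ c f ∣ ℕ.≤ δ
    bounded {form a b c} ((0<a , 0<c) , disc) = ∣a∣≤δ , ∣b∣≤δ , ∣c∣≤δ
      where
      sum≡δ : ∣ b ∣ ℕ.* ∣ b ∣ ℕ.+ ∣ a ∣ ℕ.* ∣ c ∣ ≡ δ
      sum≡δ = ℤ.+-injective (begin
        + (∣ b ∣ ℕ.* ∣ b ∣ ℕ.+ ∣ a ∣ ℕ.* ∣ c ∣)       ≡⟨ ℤ.pos-+ (∣ b ∣ ℕ.* ∣ b ∣) (∣ a ∣ ℕ.* ∣ c ∣) ⟩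
        + (∣ b ∣ ℕ.* ∣ b ∣) + + (∣ a ∣ ℕ.* ∣ c ∣)     ≡⟨ cong₂ _+_ (+∣i∣²≡i² b) (ℤ.pos-* ∣ a ∣ ∣ c ∣) ⟩
        b * b + + ∣ a ∣ * + ∣ c ∣                     ≡⟨ cong₂ (λ x y → b * b + x * y) (0<i⇒+∣i∣≡i 0<a) (0<i⇒+∣i∣≡i 0<c) ⟩
        b * b + a * c                                 ≡⟨ disc ⟩
        + δ                                           ∎)
        where open ≡-Reasoning
      open ℕ.≤-Reasoning
      instance
        a≢0 : ℕ.NonZero ∣ a ∣
        a≢0 = ℕ.>-nonZero (ℤ.drop‿+<+ (subst (+ 0 <_) (sym (0<i⇒+∣i∣≡i 0<a)) 0<a))
        c≢0 : ℕ.NonZero ∣ c ∣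
        c≢0 = ℕ.>-nonZero (ℤ.drop‿+<+ (subst (+ 0 <_) (sym (0<i⇒+∣i∣≡i 0<c)) 0<c))
      ac≤δ : ∣ a ∣ ℕ.* ∣ c ∣ ℕ.≤ δ
      ac≤δ = begin
        ∣ a ∣ ℕ.* ∣ c ∣                         ≤⟨ ℕ.m≤n+m _ _ ⟩
        ∣ b ∣ ℕ.* ∣ b ∣ ℕ.+ ∣ a ∣ ℕ.* ∣ c ∣     ≡⟨ sum≡δ ⟩
        δ                                       ∎
      ∣a∣≤δ : ∣ a ∣ ℕ.≤ δ
      ∣a∣≤δ = ℕ.≤-trans (ℕ.m≤m*n ∣ a ∣ ∣ c ∣) ac≤δ
      ∣c∣≤δ : ∣ c ∣ ℕ.≤ δ
      ∣c∣≤δ = ℕ.≤-trans (ℕ.m≤n*m ∣ c ∣ ∣ a ∣) ac≤δ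
      ∣b∣≤δ : ∣ b ∣ ℕ.≤ δ
      ∣b∣≤δ = begin
        ∣ b ∣                                   ≤⟨ n≤n*n ∣ b ∣ ⟩
        ∣ b ∣ ℕ.* ∣ b ∣                         ≤⟨ ℕ.m≤m+n _ _ ⟩
        ∣ b ∣ ℕ.* ∣ b ∣ ℕ.+ ∣ a ∣ ℕ.* ∣ c ∣     ≡⟨ sum≡δ ⟩
        δ                                       ∎

    signBit : ℤ → ℕ
    signBit (+ _)        = 0
    signBit (ℤ.-[1+ _ ]) = 1

    signBit<2 : ∀ i → signBit i ℕ.< 2
    signBit<2 (+ _)        = s≤s z≤n
    signBit<2 (ℤ.-[1+ _ ]) = s≤s (s≤s z≤n)

    signBit-∣∣-injective : ∀ i j → signBit i ≡ signBit j → ∣ i ∣ ≡ ∣ j ∣ → i ≡ j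
    signBit-∣∣-injective (+ _)        (+ _)        _ refl = refl
    signBit-∣∣-injective (ℤ.-[1+ _ ]) (ℤ.-[1+ _ ]) _ refl = refl

    -- The coefficients a and c are positive, so their absolute values determine them; only b needs
    -- a sign bit. The pigeonhole principle is applied to this code.
    module Code {f : Form} (h : OfDiscriminantδ f) where
      ∣a∣-code ∣b∣-code ∣c∣-code : Fin (suc δ)
      ∣a∣-code = fromℕ< (s≤s (proj₁ (bounded {f} h)))
      ∣b∣-code = fromℕ< (s≤s (proj₁ (proj₂ (bounded {f} h))))
      ∣c∣-code = fromℕ< (s≤s (proj₂ (proj₂ (bounded {f} h))))

      b-code : Fin (2 ℕ.* suc δ)
      b-code = combine (fromℕ< (signBit<2 (b f))) ∣b∣-code

      ac-code : Fin (suc δ ℕ.* suc δ)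
      ac-code = combine ∣a∣-code ∣c∣-code

      code : Fin ((suc δ ℕ.* suc δ) ℕ.* (2 ℕ.* suc δ))
      code = combine ac-code b-code

    code-injective : ∀ {f g} (hf : OfDiscriminantδ f) (hg : OfDiscriminantδ g) →
                     Code.code {f} hf ≡ Code.code {g} hg → f ≡ g
    code-injective {f} {g} hf@((0<a , 0<c) , _) hg@((0<a′ , 0<c′) , _) eq =
      form-≡
        (abs-injective 0<a 0<a′ (fromℕ<-injective ∣ a f ∣ ∣ a g ∣ _ _ (proj₁ ac≡)))
        (signBit-∣∣-injective (b f) (b g)
          (fromℕ<-injective (signBit (b f)) (signBit (b g)) _ _ (proj₁ b≡))
          (fromℕ<-injective ∣ b f ∣ ∣ b g ∣ _ _ (proj₂ b≡)))
        (abs-injective 0<c 0<c′ (fromℕ<-injective ∣ c f ∣ ∣ c g ∣ _ _ (proj₂ ac≡)))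
      where
      module F = Code {f} hf
      module G = Code {g} hg
      abs-injective : ∀ {i j} → + 0 < i → + 0 < j → ∣ i ∣ ≡ ∣ j ∣ → i ≡ j
      abs-injective 0<i 0<j eq = trans (sym (0<i⇒+∣i∣≡i 0<i)) (trans (cong +_ eq) (0<i⇒+∣i∣≡i 0<j))
      codes≡ : F.ac-code ≡ G.ac-code × F.b-code ≡ G.b-code
      codes≡ = combine-injective F.ac-code F.b-code G.ac-code G.b-code eq
      ac≡ : F.∣a∣-code ≡ G.∣a∣-code × F.∣c∣-code ≡ G.∣c∣-code
      ac≡ = combine-injective F.∣a∣-code F.∣c∣-code G.∣a∣-code G.∣c∣-code (proj₁ codes≡)
      b≡ : fromℕ< (signBit<2 (b f)) ≡ fromℕ< (signBit<2 (b g)) × F.∣b∣-code ≡ G.∣b∣-code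
      b≡ = combine-injective (fromℕ< (signBit<2 (b f))) F.∣b∣-code (fromℕ< (signBit<2 (b g))) G.∣b∣-code (proj₂ codes≡)

    orbit-returns : ∃[ k ] orbit 0 ≡ orbit (suc k)
    orbit-returns = let i , d , eq = repetition (λ k → Code.code {orbit k} (orbit-discriminant k)) in
      d , orbit-cancel i (suc d)
            (code-injective {orbit i} {orbit (i ℕ.+ suc d)} (orbit-discriminant i) (orbit-discriminant (i ℕ.+ suc d)) eq)

    -- f is x² − δ y² in the coordinates given by the matrix (x z ; y w).
    record Represents (f : Form) (x y z w : ℕ) : Set where
      field
        0<x : 0 ℕ.< x
        0<w : 0 ℕ.< w
        a≡  : a f ≡ + x * + x - + δ * (+ y * + y)
        b≡  : b f ≡ + x * + z - + δ * (+ y * + w)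
        c≡  : c f ≡ + δ * (+ w * + w) - + z * + z

    orbit-0-represents : Represents (orbit 0) 1 0 0 1
    orbit-0-represents = record
      { 0<x = s≤s z≤n ; 0<w = s≤s z≤n ; a≡ = lemma₁ (+ δ) ; b≡ = lemma₂ (+ δ) ; c≡ = lemma₃ (+ δ) }
      where
      lemma₁ : ∀ d → + 1 ≡ + 1 * + 1 - d * (+ 0 * + 0)
      lemma₁ = ℤ-Solver.solve-∀
      lemma₂ : ∀ d → + 0 ≡ + 1 * + 0 - d * (+ 0 * + 1)
      lemma₂ = ℤ-Solver.solve-∀
      lemma₃ : ∀ d → d ≡ d * (+ 1 * + 1) - + 0 * + 0
      lemma₃ = ℤ-Solver.solve-∀

    -- The substitutions add one column of the matrix to the other. The bound on y′ + z′ records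
    -- that after at least one step the matrix is no longer diagonal, which later excludes the
    -- trivial solution q = 1, v = 0.
    step-represents : ∀ {f x y z w} → Represents f x y z w →
      ∃₂ λ x′ y′ → ∃₂ λ z′ w′ → Represents (step f) x′ y′ z′ w′ × 0 ℕ.< y′ ℕ.+ z′
    step-represents {f@(form a b c)} {x} {y} {z} {w} r with step-cases f
    ... | inj₁ (_ , eq) = x ℕ.+ z , y ℕ.+ w , z , w , subst (λ g → Represents g _ _ _ _) (sym eq) record
      { 0<x = ℕ.<-≤-trans 0<x (ℕ.m≤m+n x z) ; 0<w = 0<w
      ; a≡ = trans (cong₂ _-_ (cong₂ (λ i j → i + (j + j)) a≡ b≡) c≡)
                   (lemma₁ (+ δ) (+ x) (+ y) (+ z) (+ w))
      ; b≡ = trans (cong₂ _-_ b≡ c≡) (lemma₂ (+ δ) (+ x) (+ y) (+ z) (+ w))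
      ; c≡ = c≡
      } , ℕ.<-≤-trans 0<w (ℕ.≤-trans (ℕ.m≤n+m w y) (ℕ.m≤m+n (y ℕ.+ w) z))
      where
      open Represents r
      lemma₁ : ∀ d x y z w → (x * x - d * (y * y)) + ((x * z - d * (y * w)) + (x * z - d * (y * w))) - (d * (w * w) - z * z)
               ≡ (x + z) * (x + z) - d * ((y + w) * (y + w))
      lemma₁ = ℤ-Solver.solve-∀
      lemma₂ : ∀ d x y z w → (x * z - d * (y * w)) - (d * (w * w) - z * z)
               ≡ (x + z) * z - d * ((y + w) * w)
      lemma₂ = ℤ-Solver.solve-∀
    ... | inj₂ (_ , eq) = x , y , x ℕ.+ z , y ℕ.+ w , subst (λ g → Represents g _ _ _ _) (sym eq) record
      { 0<x = 0<x ; 0<w = ℕ.<-≤-trans 0<w (ℕ.m≤n+m w y)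
      ; a≡ = a≡
      ; b≡ = trans (cong₂ _+_ a≡ b≡) (lemma₂ (+ δ) (+ x) (+ y) (+ z) (+ w))
      ; c≡ = trans (cong -_ (cong₂ _-_ (cong₂ (λ i j → i + (j + j)) a≡ b≡) c≡))
                   (lemma₃ (+ δ) (+ x) (+ y) (+ z) (+ w))
      } , ℕ.<-≤-trans 0<x (ℕ.≤-trans (ℕ.m≤m+n x z) (ℕ.m≤n+m (x ℕ.+ z) y))
      where
      open Represents r
      lemma₃ : ∀ d x y z w → - ((x * x - d * (y * y)) + ((x * z - d * (y * w)) + (x * z - d * (y * w))) - (d * (w * w) - z * z))
               ≡ d * ((y + w) * (y + w)) - (x + z) * (x + z)
      lemma₃ = ℤ-Solver.solve-∀
      lemma₂ : ∀ d x y z w → (x * x - d * (y * y)) + (x * z - d * (y * w))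
               ≡ x * (x + z) - d * (y * (y + w))
      lemma₂ = ℤ-Solver.solve-∀

    orbit-represents : ∀ k → ∃₂ λ x y → ∃₂ λ z w → Represents (orbit k) x y z w
    orbit-represents zero = _ , _ , _ , _ , orbit-0-represents
    orbit-represents (suc k) with _ , _ , _ , _ , r ← orbit-represents k
      with x , y , z , w , r′ , _ ← step-represents r = x , y , z , w , r′

    unit-of-return : ∀ {x y z w} → Represents (orbit 0) x y z w → 0 ℕ.< y ℕ.+ z →
                     0 ℕ.< y × x ℕ.* x ≡ 1 ℕ.+ δ ℕ.* (y ℕ.* y)
    unit-of-return {x} {y} {z} {w} r 0<y+z = ℕ.n≢0⇒n>0 y≢0 , ℤ.+-injective (begin
      + (x ℕ.* x)                                                  ≡⟨ ℤ.pos-* x x ⟩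
      + x * + x                                                    ≡⟨ move (+ x * + x) (+ δ * (+ y * + y)) ⟩
      + x * + x - + δ * (+ y * + y) + + δ * (+ y * + y)            ≡⟨ cong (_+ + δ * (+ y * + y)) (sym a≡) ⟩
      + 1 + + δ * (+ y * + y)                                      ≡⟨ cong (λ i → + 1 + + δ * i) (ℤ.pos-* y y) ⟨
      + 1 + + δ * + (y ℕ.* y)                                      ≡⟨ cong (λ i → + 1 + i) (ℤ.pos-* δ (y ℕ.* y)) ⟨
      + (1 ℕ.+ δ ℕ.* (y ℕ.* y))                                    ∎)
      where
      open Represents r
      open ≡-Reasoning
      move : ∀ i j → i ≡ i - j + j
      move = ℤ-Solver.solve-∀
      -- If y = 0, then b = x z. As b = 0 on return and x > 0, also z = 0, contradicting y + z > 0.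
      y≢0 : y ≢ 0
      y≢0 y≡0 = ℕ.m<n⇒n≢0 0<y+z (cong₂ ℕ._+_ y≡0
        (ℕ.*-cancelˡ-≡ z 0 x {{ℕ.>-nonZero 0<x}} (ℤ.+-injective (begin
          + (x ℕ.* z)                        ≡⟨ ℤ.pos-* x z ⟩
          + x * + z                          ≡⟨ identity (+ x * + z) (+ δ) (+ w) ⟩
          + x * + z - + δ * (+ 0 * + w)      ≡⟨ cong (λ i → + x * + z - + δ * (+ i * + w)) y≡0 ⟨
          + x * + z - + δ * (+ y * + w)      ≡⟨ b≡ ⟨
          + 0                                ≡⟨ cong +_ (ℕ.*-zeroʳ x) ⟨
          + (x ℕ.* 0)                        ∎))))
        where
        identity : ∀ i d w → i ≡ i - d * (+ 0 * w)
        identity = ℤ-Solver.solve-∀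

  record PellSolution (δ : ℕ) : Set where
    field
      q v  : ℕ
      0<v  : 0 ℕ.< v
      pell : q ℕ.* q ≡ 1 ℕ.+ δ ℕ.* (v ℕ.* v)

  open PellSolution public

  0<q : ∀ {δ} (s : PellSolution δ) → 0 ℕ.< q s
  0<q s = ℕ.n≢0⇒n>0 λ q≡0 → ℕ.1+n≢0 (trans (sym (pell s)) (cong (ℕ._* q s) q≡0))

  pellSolution : ∀ {δ} → NonSquare δ → PellSolution δ
  pellSolution {δ} δ-nonSquare = fromReturn (orbit-returns δ-nonSquare)
    where
    fromUnit : ∀ {g} → orbit δ-nonSquare 0 ≡ g →
      (∃₂ λ x y → ∃₂ λ z w → Represents δ-nonSquare g x y z w × 0 ℕ.< y ℕ.+ z) → PellSolution δ
    fromUnit refl (x , y , _ , _ , r , 0<y+z) = record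
      { q = x ; v = y
      ; 0<v  = proj₁ (unit-of-return δ-nonSquare r 0<y+z)
      ; pell = proj₂ (unit-of-return δ-nonSquare r 0<y+z)
      }
    fromReturn : (∃[ k ] orbit δ-nonSquare 0 ≡ orbit δ-nonSquare (suc k)) → PellSolution δ
    fromReturn (k , return) = fromUnit return
      (step-represents δ-nonSquare (proj₂ (proj₂ (proj₂ (proj₂ (orbit-represents δ-nonSquare k))))))

  -- Infinitely many Pell solutions with growing q

  module Powers {δ : ℕ} (0<δ : 0 ℕ.< δ) (fundamental : PellSolution δ) where

    -- the powers of q + v √δ for the fundamental q and v
    power : ℕ → PellSolution δ
    power zero    = fundamental
    power (suc n) = record
      { q    = q₁ ℕ.* qₙ ℕ.+ δ ℕ.* (v₁ ℕ.* vₙ)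
      ; v    = q₁ ℕ.* vₙ ℕ.+ v₁ ℕ.* qₙ
      ; 0<v  = ℕ.<-≤-trans (ℕ.*-mono-< (0<q fundamental) (0<v (power n))) (ℕ.m≤m+n _ _)
      ; pell = begin
          (q₁ ℕ.* qₙ ℕ.+ δ ℕ.* (v₁ ℕ.* vₙ)) ℕ.* (q₁ ℕ.* qₙ ℕ.+ δ ℕ.* (v₁ ℕ.* vₙ))   ≡⟨ expand q₁ v₁ qₙ vₙ δ ⟩
          (q₁ ℕ.* q₁) ℕ.* (qₙ ℕ.* qₙ) ℕ.+ cross
            ≡⟨ cong₂ (λ x y → x ℕ.* y ℕ.+ cross) (pell fundamental) (pell (power n)) ⟩
          (1 ℕ.+ δ ℕ.* (v₁ ℕ.* v₁)) ℕ.* (1 ℕ.+ δ ℕ.* (vₙ ℕ.* vₙ)) ℕ.+ cross       ≡⟨ regroup v₁ vₙ δ (q₁ ℕ.* qₙ) ⟩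
          1 ℕ.+ δ ℕ.* ((1 ℕ.+ δ ℕ.* (v₁ ℕ.* v₁)) ℕ.* (vₙ ℕ.* vₙ) ℕ.+ (v₁ ℕ.* v₁) ℕ.* (1 ℕ.+ δ ℕ.* (vₙ ℕ.* vₙ)) ℕ.+ 2 ℕ.* (q₁ ℕ.* qₙ) ℕ.* (v₁ ℕ.* vₙ))
            ≡⟨ cong₂ (λ x y → 1 ℕ.+ δ ℕ.* (x ℕ.* (vₙ ℕ.* vₙ) ℕ.+ (v₁ ℕ.* v₁) ℕ.* y ℕ.+ 2 ℕ.* (q₁ ℕ.* qₙ) ℕ.* (v₁ ℕ.* vₙ))) (pell fundamental) (pell (power n)) ⟨
          1 ℕ.+ δ ℕ.* ((q₁ ℕ.* q₁) ℕ.* (vₙ ℕ.* vₙ) ℕ.+ (v₁ ℕ.* v₁) ℕ.* (qₙ ℕ.* qₙ) ℕ.+ 2 ℕ.* (q₁ ℕ.* qₙ) ℕ.* (v₁ ℕ.* vₙ))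
            ≡⟨ cong (λ x → 1 ℕ.+ δ ℕ.* x) (collect q₁ v₁ qₙ vₙ) ⟩
          1 ℕ.+ δ ℕ.* ((q₁ ℕ.* vₙ ℕ.+ v₁ ℕ.* qₙ) ℕ.* (q₁ ℕ.* vₙ ℕ.+ v₁ ℕ.* qₙ))   ∎
      }
      where
      open ≡-Reasoning
      q₁ v₁ qₙ vₙ cross : ℕ
      q₁ = q fundamental
      v₁ = v fundamental
      qₙ = q (power n)
      vₙ = v (power n)
      -- Brahmagupta's identity without subtraction: inserting both Pell equations next to these
      -- cross terms splits off the 1, and reading the equations backwards turns the remainder into
      -- δ times a square.
      cross = δ ℕ.* (2 ℕ.* (q₁ ℕ.* qₙ) ℕ.* (v₁ ℕ.* vₙ) ℕ.+ δ ℕ.* ((v₁ ℕ.* v₁) ℕ.* (vₙ ℕ.* vₙ)))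
      expand : ∀ a b c d δ → (a ℕ.* c ℕ.+ δ ℕ.* (b ℕ.* d)) ℕ.* (a ℕ.* c ℕ.+ δ ℕ.* (b ℕ.* d))
        ≡ (a ℕ.* a) ℕ.* (c ℕ.* c) ℕ.+ δ ℕ.* (2 ℕ.* (a ℕ.* c) ℕ.* (b ℕ.* d) ℕ.+ δ ℕ.* ((b ℕ.* b) ℕ.* (d ℕ.* d)))
      expand = ℕ-Solver.solve-∀
      regroup : ∀ b d δ t → (1 ℕ.+ δ ℕ.* (b ℕ.* b)) ℕ.* (1 ℕ.+ δ ℕ.* (d ℕ.* d)) ℕ.+ δ ℕ.* (2 ℕ.* t ℕ.* (b ℕ.* d) ℕ.+ δ ℕ.* ((b ℕ.* b) ℕ.* (d ℕ.* d)))
        ≡ 1 ℕ.+ δ ℕ.* ((1 ℕ.+ δ ℕ.* (b ℕ.* b)) ℕ.* (d ℕ.* d) ℕ.+ (b ℕ.* b) ℕ.* (1 ℕ.+ δ ℕ.* (d ℕ.* d)) ℕ.+ 2 ℕ.* t ℕ.* (b ℕ.* d))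
      regroup = ℕ-Solver.solve-∀
      collect : ∀ a b c d → (a ℕ.* a) ℕ.* (d ℕ.* d) ℕ.+ (b ℕ.* b) ℕ.* (c ℕ.* c) ℕ.+ 2 ℕ.* (a ℕ.* c) ℕ.* (b ℕ.* d)
        ≡ (a ℕ.* d ℕ.+ b ℕ.* c) ℕ.* (a ℕ.* d ℕ.+ b ℕ.* c)
      collect = ℕ-Solver.solve-∀

    1<q : ∀ (s : PellSolution δ) → 1 ℕ.< q s
    1<q s = ℕ.≮⇒≥ λ q<2 → ℕ.<⇒≱ (ℕ.*-mono-< {0} {δ} {0} 0<δ (ℕ.*-mono-< (0<v s) (0<v s)))
      (ℕ.s≤s⁻¹ (subst (ℕ._≤ 1) (pell s) (ℕ.*-mono-≤ (ℕ.s≤s⁻¹ q<2) (ℕ.s≤s⁻¹ q<2))))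

    q-increasing : ∀ n → q (power n) ℕ.< q (power (suc n))
    q-increasing n = ℕ.<-≤-trans
      (subst (q (power n) ℕ.<_) (ℕ.*-comm (q (power n)) (q fundamental))
        (ℕ.m<m*n (q (power n)) (q fundamental) {{ℕ.>-nonZero (ℕ.<⇒≤ (1<q (power n)))}} (1<q fundamental)))
      (ℕ.m≤m+n _ _)

    q-large : ∀ n → n ℕ.< q (power n)
    q-large zero    = ℕ.<⇒≤ (1<q fundamental)
    q-large (suc n) = ℕ.≤-<-trans (q-large n) (q-increasing n)

    q-mono-< : ∀ {i j} → i ℕ.< j → q (power i) ℕ.< q (power j)
    q-mono-< {i} {suc j} i<1+j with ℕ.m≤n⇒m<n∨m≡n (ℕ.s≤s⁻¹ i<1+j)
    ... | inj₁ i<j  = ℕ.<-trans (q-mono-< i<j) (q-increasing j)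
    ... | inj₂ refl = q-increasing j

    q-injective : ∀ {i j} → q (power i) ≡ q (power j) → i ≡ j
    q-injective {i} {j} eq with ℕ.<-cmp i j
    ... | tri< i<j _ _ = contradiction eq (ℕ.<⇒≢ (q-mono-< i<j))
    ... | tri≈ _ i≡j _ = i≡j
    ... | tri> _ _ j<i = contradiction (sym eq) (ℕ.<⇒≢ (q-mono-< j<i))

-- Continuants as entries of matrix products

module Continuants where
  open import Data.Nat.Base using (_+_; _*_; _≤_; _<_)

  record Mat : Set where
    constructor mat
    field
      A B C D : ℕ

  open Mat public

  infixl 7 _⊗_

  _⊗_ : Mat → Mat → Mat
  mat A B C D ⊗ mat A′ B′ C′ D′ =
    mat (A * A′ + B * C′) (A * B′ + B * D′) (C * A′ + D * C′) (C * B′ + D * D′)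

  _ᵀ : Mat → Mat
  mat A B C D ᵀ = mat A C B D

  -- Left multiplication by (a 1 ; 1 0), without the spurious factors 1 and 0.
  prepend : ℕ → Mat → Mat
  prepend a (mat A B C D) = mat (a * A + C) (a * B + D) A B

  ⟦_⟧ : List ℕ → Mat
  ⟦ []     ⟧ = mat 1 0 0 1
  ⟦ a ∷ as ⟧ = prepend a ⟦ as ⟧

  mat-≡ : ∀ {A A′ B B′ C C′ D D′} → A ≡ A′ → B ≡ B′ → C ≡ C′ → D ≡ D′ → mat A B C D ≡ mat A′ B′ C′ D′
  mat-≡ refl refl refl refl = refl

  ⟦⟧-++ : ∀ as bs → ⟦ as ++ bs ⟧ ≡ ⟦ as ⟧ ⊗ ⟦ bs ⟧
  ⟦⟧-++ [] bs = mat-≡ (unit (A ⟦ bs ⟧) (C ⟦ bs ⟧)) (unit (B ⟦ bs ⟧) (D ⟦ bs ⟧)) (sym (ℕ.+-identityʳ _)) (sym (ℕ.+-identityʳ _))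
    where
    unit : ∀ x y → x ≡ x + 0 + 0 * y
    unit = ℕ-Solver.solve-∀
  ⟦⟧-++ (a ∷ as) bs = trans (cong (prepend a) (⟦⟧-++ as bs)) (prepend-⊗ ⟦ as ⟧ ⟦ bs ⟧)
    where
    entry : ∀ a x y z w u v → a * (x * u + y * v) + (z * u + w * v) ≡ (a * x + z) * u + (a * y + w) * v
    entry = ℕ-Solver.solve-∀
    prepend-⊗ : ∀ M N → prepend a (M ⊗ N) ≡ prepend a M ⊗ N
    prepend-⊗ (mat A B C D) (mat A′ B′ C′ D′) =
      mat-≡ (entry a A B C D A′ C′) (entry a A B C D B′ D′) refl refl

  -- Each factor (a 1 ; 1 0) is symmetric, so transposing the product only reverses the order of the
  -- factors.
  ⟦⟧-reverse : ∀ as → ⟦ reverse as ⟧ ≡ ⟦ as ⟧ ᵀ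
  ⟦⟧-reverse []       = refl
  ⟦⟧-reverse (a ∷ as) = begin
    ⟦ reverse (a ∷ as) ⟧            ≡⟨ cong ⟦_⟧ (List.unfold-reverse a as) ⟩
    ⟦ reverse as ∷ʳ a ⟧             ≡⟨ ⟦⟧-++ (reverse as) (a ∷ []) ⟩
    ⟦ reverse as ⟧ ⊗ ⟦ a ∷ [] ⟧     ≡⟨ cong (_⊗ ⟦ a ∷ [] ⟧) (⟦⟧-reverse as) ⟩
    ⟦ as ⟧ ᵀ ⊗ ⟦ a ∷ [] ⟧           ≡⟨ transposed ⟦ as ⟧ ⟩
    prepend a ⟦ as ⟧ ᵀ              ∎
    where
    open ≡-Reasoning
    entry₁ : ∀ a x y → x * (a * 1 + 0) + y * 1 ≡ a * x + y
    entry₁ = ℕ-Solver.solve-∀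
    entry₂ : ∀ a x y → x * (a * 0 + 1) + y * 0 ≡ x
    entry₂ = ℕ-Solver.solve-∀
    transposed : ∀ M → M ᵀ ⊗ ⟦ a ∷ [] ⟧ ≡ prepend a M ᵀ
    transposed (mat A B C D) = mat-≡ (entry₁ a A C) (entry₂ a A C) (entry₁ a B D) (entry₂ a B D)

  det : Mat → ℤ
  det (mat A B C D) = + A ℤ.* + D ℤ.- + B ℤ.* + C

  +[m*n+o] : ∀ m n o → + (m * n + o) ≡ + m ℤ.* + n ℤ.+ + o
  +[m*n+o] m n o = cong (ℤ._+ + o) (ℤ.pos-* m n)

  +[m*n+o*p] : ∀ m n o p → + (m * n + o * p) ≡ + m ℤ.* + n ℤ.+ + o ℤ.* + p
  +[m*n+o*p] m n o p = cong₂ ℤ._+_ (ℤ.pos-* m n) (ℤ.pos-* o p)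

  det-prepend : ∀ a M → det (prepend a M) ≡ ℤ.- det M
  det-prepend a (mat A B C D) =
    trans (cong₂ (λ x y → x ℤ.* + B ℤ.- y ℤ.* + A) (+[m*n+o] a A C) (+[m*n+o] a B D))
          (identity (+ a) (+ A) (+ B) (+ C) (+ D))
    where
    identity : ∀ a x y z w → (a ℤ.* x ℤ.+ z) ℤ.* y ℤ.- (a ℤ.* y ℤ.+ w) ℤ.* x ≡ ℤ.- (x ℤ.* w ℤ.- y ℤ.* z)
    identity = ℤ-Solver.solve-∀

  det-⊗ : ∀ M N → det (M ⊗ N) ≡ det M ℤ.* det N
  det-⊗ (mat A B C D) (mat A′ B′ C′ D′) =
    trans (cong₂ ℤ._-_ (cong₂ ℤ._*_ (+[m*n+o*p] A A′ B C′) (+[m*n+o*p] C B′ D D′))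
                       (cong₂ ℤ._*_ (+[m*n+o*p] A B′ B D′) (+[m*n+o*p] C A′ D C′)))
          (identity (+ A) (+ B) (+ C) (+ D) (+ A′) (+ B′) (+ C′) (+ D′))
    where
    identity : ∀ x y z w x′ y′ z′ w′ →
      (x ℤ.* x′ ℤ.+ y ℤ.* z′) ℤ.* (z ℤ.* y′ ℤ.+ w ℤ.* w′) ℤ.- (x ℤ.* y′ ℤ.+ y ℤ.* w′) ℤ.* (z ℤ.* x′ ℤ.+ w ℤ.* z′)
        ≡ (x ℤ.* w ℤ.- y ℤ.* z) ℤ.* (x′ ℤ.* w′ ℤ.- y′ ℤ.* z′)
    identity = ℤ-Solver.solve-∀

  det-ᵀ : ∀ M → det (M ᵀ) ≡ det M
  det-ᵀ (mat A B C D) = cong (λ x → + A ℤ.* + D ℤ.- x) (ℤ.*-comm (+ C) (+ B))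

  det-⟦⟧ : ∀ as → det ⟦ as ⟧ ≡ + 1 ⊎ det ⟦ as ⟧ ≡ ℤ.- + 1
  det-⟦⟧ []       = inj₁ refl
  det-⟦⟧ (a ∷ as) with det-⟦⟧ as
  ... | inj₁ eq = inj₂ (trans (det-prepend a ⟦ as ⟧) (cong ℤ.-_ eq))
  ... | inj₂ eq = inj₁ (trans (det-prepend a ⟦ as ⟧) (cong ℤ.-_ eq))

  continuant : List ℕ → ℕ
  continuant as = A ⟦ as ⟧

  coprime-columns : ∀ as → ℕ.Coprime (A ⟦ as ⟧) (C ⟦ as ⟧)
  coprime-columns []       (d∣1 , _)  = ℕ.∣1⇒≡1 d∣1
  coprime-columns (a ∷ as) (d∣A , d∣C) =
    coprime-columns as (d∣C , ℕ.∣m+n∣m⇒∣n d∣A (ℕ.∣n⇒∣m*n a d∣C))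

  -- Making both end digits at least 2

  module _ {m : ℕ} where

    Digits : List ℕ → Set
    Digits = All (Between1And m)

    -- Passing from p/q to 1 - p/q keeps the denominator and replaces leading digits 1, c by c + 1.
    -- The first digit is returned as `suc a` with a itself in range, so that it can later be
    -- lowered by 1.
    enlarge-first : ∀ {as} → Digits as → m + 2 < continuant as →
      ∃₂ λ a bs → Between1And m a × Digits bs × continuant (suc a ∷ bs) ≡ continuant as
    enlarge-first []                       large = contradiction (ℕ.≤-trans (ℕ.m≤n+m 2 m) (ℕ.<⇒≤ large)) λ { (s≤s ()) }
    enlarge-first (_∷_ {zero}        (() , _) _) large
    enlarge-first (_∷_ {suc zero}    _ [])           large = contradiction (ℕ.≤-trans (ℕ.m≤n+m 2 m) (ℕ.<⇒≤ large)) λ { (s≤s ()) }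
    enlarge-first (_∷_ {suc zero} _ (_∷_ {c} {as} 1≤c≤m as≤m)) large =
      c , as , 1≤c≤m , as≤m , identity c (A ⟦ as ⟧) (C ⟦ as ⟧)
      where
      identity : ∀ c x z → suc c * x + z ≡ 1 * (c * x + z) + x
      identity = ℕ-Solver.solve-∀
    enlarge-first (_∷_ {suc (suc c)} {as} (_ , c≤m) as≤m) large =
      suc c , as , (s≤s z≤n , ℕ.<⇒≤ c≤m) , as≤m , refl

    -- Here c + 1/1 = c + 1 absorbs a final digit 1. The threshold excludes exactly the words
    -- without a separate last digit to enlarge: `suc a` alone has continuant at most m + 1, and
    -- `suc a` followed by 1 at most m + 2.
    enlarge-last : ∀ {a bs} → Between1And m a → Digits bs → m + 2 < continuant (suc a ∷ bs) →
      ∃₂ λ mid b → Between1And m b × Digits mid × continuant (suc a ∷ mid ∷ʳ suc b) ≡ continuant (suc a ∷ bs)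
    enlarge-last {a} {bs} (_ , a≤m) bs≤m large with initLast bs
    ... | [] = contradiction large (ℕ.≤⇒≯ (begin
      suc a * 1 + 0 ≡⟨ trans (ℕ.+-identityʳ _) (ℕ.*-identityʳ _) ⟩
      suc a         ≤⟨ s≤s a≤m ⟩
      suc m         ≤⟨ ℕ.n≤1+n (suc m) ⟩
      2 + m         ≡⟨ ℕ.+-comm 2 m ⟩
      m + 2         ∎))
      where open ℕ.≤-Reasoning
    ... | mid ∷ʳ′ d with All.∷ʳ⁻ bs≤m
    enlarge-last {a} a≤m bs≤m large | mid ∷ʳ′ zero        | _ , () , _
    enlarge-last {a} a≤m bs≤m large | mid ∷ʳ′ suc (suc d) | mid≤m , _ , d≤m =
      mid , suc d , (s≤s z≤n , ℕ.<⇒≤ d≤m) , mid≤m , refl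
    enlarge-last {a} _ bs≤m large | mid ∷ʳ′ suc zero | mid≤m , _ with initLast mid
    enlarge-last {a} (_ , a≤m) bs≤m large | .[] ∷ʳ′ suc zero | mid≤m , _ | [] =
      contradiction large (ℕ.≤⇒≯ (begin
        suc a * 1 + 1 ≡⟨ cong (_+ 1) (ℕ.*-identityʳ (suc a)) ⟩
        suc a + 1     ≤⟨ ℕ.+-monoˡ-≤ 1 (s≤s a≤m) ⟩
        suc m + 1     ≡⟨ ℕ.+-suc m 1 ⟨
        m + 2         ∎))
      where open ℕ.≤-Reasoning
    enlarge-last {a} _ bs≤m large | .(us ∷ʳ c) ∷ʳ′ suc zero | mid≤m , _ | us ∷ʳ′ c
      with us≤m , c≤m ← All.∷ʳ⁻ mid≤m
      = us , c , c≤m , us≤m , (begin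
        A ⟦ aus ∷ʳ suc c ⟧                        ≡⟨ cong A (⟦⟧-++ aus (suc c ∷ [])) ⟩
        A (⟦ aus ⟧ ⊗ ⟦ suc c ∷ [] ⟧)              ≡⟨ identity c (A ⟦ aus ⟧) (B ⟦ aus ⟧) ⟩
        A ((⟦ aus ⟧ ⊗ ⟦ c ∷ [] ⟧) ⊗ ⟦ 1 ∷ [] ⟧)   ≡⟨ cong (λ M → A (M ⊗ ⟦ 1 ∷ [] ⟧)) (⟦⟧-++ aus (c ∷ [])) ⟨
        A (⟦ aus ∷ʳ c ⟧ ⊗ ⟦ 1 ∷ [] ⟧)             ≡⟨ cong A (⟦⟧-++ (aus ∷ʳ c) (1 ∷ [])) ⟨
        A ⟦ (aus ∷ʳ c) ∷ʳ 1 ⟧                     ∎)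
      where
      open ≡-Reasoning
      aus = suc a ∷ us
      identity : ∀ c x y → x * (suc c * 1 + 0) + y * 1
                 ≡ (x * (c * 1 + 0) + y * 1) * (1 * 1 + 0) + (x * (c * 0 + 1) + y * 0) * 1
      identity = ℕ-Solver.solve-∀

    normalise : ∀ {as} → Digits as → m + 2 < continuant as →
      ∃₂ λ a b → ∃ λ mid → Between1And m a × Between1And m b × Digits mid ×
        continuant (suc a ∷ mid ∷ʳ suc b) ≡ continuant as
    normalise as≤m large
      with a , bs , a≤m , bs≤m , eq ← enlarge-first as≤m large
      with mid , b , b≤m , mid≤m , eq′ ← enlarge-last a≤m bs≤m (subst (m + 2 <_) (sym eq) large)
      = a , b , mid , a≤m , b≤m , mid≤m , trans eq′ eq

  -- The folded word: trace, determinant and lower left entry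

  All-reverse : ∀ {P : ℕ → Set} {as} → All P as → All P (reverse as)
  All-reverse []                   = []
  All-reverse {P} (_∷_ {a} {as} p ps) =
    subst (All P) (sym (List.unfold-reverse a as)) (All.∷ʳ⁺ (All-reverse ps) p)

  -- Multiplication by (1 1 ; 0 1) on the left and by (1 0 ; 1 1) on the right: the effect of
  -- raising the first or the last digit by 1.
  addRows addCols : Mat → Mat
  addRows (mat A B C D) = mat (A + C) (B + D) C D
  addCols (mat A B C D) = mat (A + B) B (C + D) D

  ⟦suc∷⟧ : ∀ a as → ⟦ suc a ∷ as ⟧ ≡ addRows ⟦ a ∷ as ⟧
  ⟦suc∷⟧ a as = mat-≡ (identity a (A ⟦ as ⟧) (C ⟦ as ⟧)) (identity a (B ⟦ as ⟧) (D ⟦ as ⟧)) refl refl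
    where
    identity : ∀ a x y → suc a * x + y ≡ a * x + y + x
    identity = ℕ-Solver.solve-∀

  ⟦∷ʳsuc⟧ : ∀ as b → ⟦ as ∷ʳ suc b ⟧ ≡ addCols ⟦ as ∷ʳ b ⟧
  ⟦∷ʳsuc⟧ as b = trans (⟦⟧-++ as (suc b ∷ [])) (trans
    (mat-≡ (identity₁ b (A ⟦ as ⟧) (B ⟦ as ⟧)) (identity₂ b (A ⟦ as ⟧) (B ⟦ as ⟧))
           (identity₁ b (C ⟦ as ⟧) (D ⟦ as ⟧)) (identity₂ b (C ⟦ as ⟧) (D ⟦ as ⟧)))
    (cong addCols (sym (⟦⟧-++ as (b ∷ [])))))
    where
    identity₁ : ∀ b x y → x * (suc b * 1 + 0) + y * 1 ≡ x * (b * 1 + 0) + y * 1 + (x * (b * 0 + 1) + y * 0)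
    identity₁ = ℕ-Solver.solve-∀
    identity₂ : ∀ b x y → x * (suc b * 0 + 1) + y * 0 ≡ x * (b * 0 + 1) + y * 0
    identity₂ = ℕ-Solver.solve-∀

  det-addRows : ∀ M → det (addRows M) ≡ det M
  det-addRows (mat A B C D) = identity (+ A) (+ B) (+ C) (+ D)
    where
    identity : ∀ x y z w → (x ℤ.+ z) ℤ.* w ℤ.- (y ℤ.+ w) ℤ.* z ≡ x ℤ.* w ℤ.- y ℤ.* z
    identity = ℤ-Solver.solve-∀

  det-addCols : ∀ M → det (addCols M) ≡ det M
  det-addCols (mat A B C D) = identity (+ A) (+ B) (+ C) (+ D)
    where
    identity : ∀ x y z w → (x ℤ.+ y) ℤ.* w ℤ.- y ℤ.* (z ℤ.+ w) ≡ x ℤ.* w ℤ.- y ℤ.* z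
    identity = ℤ-Solver.solve-∀

  -- Folding: 1 ∷ foldedTail as bs is the period of (p + v √δ) / q, where as and bs differ by
  -- adding 1 to the end digits.  Which of the two lists gets the larger last digit depends on
  -- the parity of their length, that is, on the determinant: ᵒ below is for odd length, ᵉ for even.
  foldedTail : List ℕ → List ℕ → List ℕ
  foldedTail as bs = as ++ (1 ∷ 1 ∷ (reverse bs ∷ʳ 1))

  foldMat : Mat → Mat → Mat
  foldMat V U = prepend 1 (V ⊗ prepend 1 (prepend 1 (U ᵀ ⊗ ⟦ 1 ∷ [] ⟧)))

  ⟦folded⟧ : ∀ as bs → ⟦ 1 ∷ foldedTail as bs ⟧ ≡ foldMat ⟦ as ⟧ ⟦ bs ⟧
  ⟦folded⟧ as bs = cong (prepend 1) (trans (⟦⟧-++ as _)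
    (cong (λ M → ⟦ as ⟧ ⊗ prepend 1 (prepend 1 M))
          (trans (⟦⟧-++ (reverse bs) (1 ∷ [])) (cong (_⊗ ⟦ 1 ∷ [] ⟧) (⟦⟧-reverse bs)))))

  det-foldMat : ∀ V U → det (foldMat V U) ≡ det V ℤ.* det U
  det-foldMat V U = begin
    det (foldMat V U)
      ≡⟨ det-prepend 1 (V ⊗ prepend 1 (prepend 1 (U ᵀ ⊗ ⟦ 1 ∷ [] ⟧))) ⟩
    ℤ.- det (V ⊗ prepend 1 (prepend 1 (U ᵀ ⊗ ⟦ 1 ∷ [] ⟧)))
      ≡⟨ cong ℤ.-_ (det-⊗ V (prepend 1 (prepend 1 (U ᵀ ⊗ ⟦ 1 ∷ [] ⟧)))) ⟩
    ℤ.- (det V ℤ.* det (prepend 1 (prepend 1 (U ᵀ ⊗ ⟦ 1 ∷ [] ⟧))))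
      ≡⟨ cong (λ i → ℤ.- (det V ℤ.* i)) (trans (det-prepend 1 (prepend 1 (U ᵀ ⊗ ⟦ 1 ∷ [] ⟧))) (cong ℤ.-_ (det-prepend 1 (U ᵀ ⊗ ⟦ 1 ∷ [] ⟧)))) ⟩
    ℤ.- (det V ℤ.* ℤ.- (ℤ.- det (U ᵀ ⊗ ⟦ 1 ∷ [] ⟧)))
      ≡⟨ cong (λ i → ℤ.- (det V ℤ.* ℤ.- (ℤ.- i))) (trans (det-⊗ (U ᵀ) ⟦ 1 ∷ [] ⟧) (cong (ℤ._* det ⟦ 1 ∷ [] ⟧) (det-ᵀ U))) ⟩
    ℤ.- (det V ℤ.* ℤ.- (ℤ.- (det U ℤ.* ℤ.- + 1)))
      ≡⟨ identity (det V) (det U) ⟩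
    det V ℤ.* det U ∎
    where
    open ≡-Reasoning
    identity : ∀ i j → ℤ.- (i ℤ.* ℤ.- (ℤ.- (j ℤ.* ℤ.- + 1))) ≡ i ℤ.* j
    identity = ℤ-Solver.solve-∀

  trace : Mat → ℕ
  trace M = A M + D M

  -- What the rest of the proof retains of the period. Trace and determinant give the discriminant δ
  -- (4 q v)², and C gives the denominator 2 C = 4 q² of the fixed point, so that √δ gets the
  -- coefficient v / q.
  record FoldedMatrix (q : ℕ) (M : Mat) : Set where
    field
      trace≡ : trace M + 2 ≡ 4 * (q * q)
      C≡     : C M ≡ 2 * (q * q)
      det≡   : det M ≡ + 1

  -- This is the top left entry of `addRows (addCols U)`, hence the continuant q of the word of U
  -- after both end digits are raised.
  sumEntries : Mat → ℕ
  sumEntries (mat A B C D) = A + B + (C + D)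

  C-foldMatᵒ : ∀ U → C (foldMat (addRows (addCols U)) U) ≡ 2 * (sumEntries U * sumEntries U)
  C-foldMatᵒ (mat A B C D) = identity A B C D
    where
    identity : ∀ x y z w →
      (x + y + (z + w)) * (1 * (1 * (x * 1 + z * 1) + (y * 1 + w * 1)) + (x * 1 + z * 1)) +
      (y + w) * (1 * (x * 1 + z * 1) + (y * 1 + w * 1))
      ≡ 2 * ((x + y + (z + w)) * (x + y + (z + w)))
    identity = ℕ-Solver.solve-∀

  C-foldMatᵉ : ∀ U → C (foldMat (addRows U) (addCols U)) ≡ 2 * (sumEntries U * sumEntries U)
  C-foldMatᵉ (mat A B C D) = identity A B C D
    where
    identity : ∀ x y z w →
      (x + z) * (1 * (1 * ((x + y) * 1 + (z + w) * 1) + (y * 1 + w * 1)) + ((x + y) * 1 + (z + w) * 1)) +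
      (y + w) * (1 * ((x + y) * 1 + (z + w) * 1) + (y * 1 + w * 1))
      ≡ 2 * ((x + y + (z + w)) * (x + y + (z + w)))
    identity = ℕ-Solver.solve-∀

  -- These are homogeneous in U; the determinant enters only through the products A D and B C.
  trace-foldMatᵒ : ∀ U → trace (foldMat (addRows (addCols U)) U) + 2 * (B U * C U)
                         ≡ 4 * (sumEntries U * sumEntries U) + 2 * (A U * D U)
  trace-foldMatᵒ (mat A B C D) = identity A B C D
    where
    identity : ∀ x y z w →
      1 * ((x + y + (z + w)) * (1 * (1 * (x * 1 + z * 1) + (y * 1 + w * 1)) + (x * 1 + z * 1)) +
           (y + w) * (1 * (x * 1 + z * 1) + (y * 1 + w * 1)))
        + ((z + w) * (1 * (1 * (x * 1 + z * 1) + (y * 1 + w * 1)) + (x * 1 + z * 1)) +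
           w * (1 * (x * 1 + z * 1) + (y * 1 + w * 1)))
        + ((x + y + (z + w)) * (1 * (1 * (x * 1 + z * 0) + (y * 1 + w * 0)) + (x * 1 + z * 0)) +
           (y + w) * (1 * (x * 1 + z * 0) + (y * 1 + w * 0)))
        + 2 * (y * z)
      ≡ 4 * ((x + y + (z + w)) * (x + y + (z + w))) + 2 * (x * w)
    identity = ℕ-Solver.solve-∀

  trace-foldMatᵉ : ∀ U → trace (foldMat (addRows U) (addCols U)) + 2 * (A U * D U)
                         ≡ 4 * (sumEntries U * sumEntries U) + 2 * (B U * C U)
  trace-foldMatᵉ (mat A B C D) = identity A B C D
    where
    identity : ∀ x y z w →
      1 * ((x + z) * (1 * (1 * ((x + y) * 1 + (z + w) * 1) + (y * 1 + w * 1)) + ((x + y) * 1 + (z + w) * 1)) +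
           (y + w) * (1 * ((x + y) * 1 + (z + w) * 1) + (y * 1 + w * 1)))
        + (z * (1 * (1 * ((x + y) * 1 + (z + w) * 1) + (y * 1 + w * 1)) + ((x + y) * 1 + (z + w) * 1)) +
           w * (1 * ((x + y) * 1 + (z + w) * 1) + (y * 1 + w * 1)))
        + ((x + z) * (1 * (1 * ((x + y) * 1 + (z + w) * 0) + (y * 1 + w * 0)) + ((x + y) * 1 + (z + w) * 0)) +
           (y + w) * (1 * ((x + y) * 1 + (z + w) * 0) + (y * 1 + w * 0)))
        + 2 * (x * w)
      ≡ 4 * ((x + y + (z + w)) * (x + y + (z + w))) + 2 * (y * z)
    identity = ℕ-Solver.solve-∀

  det≡1⇒ : ∀ M → det M ≡ + 1 → A M * D M ≡ 1 + B M * C M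
  det≡1⇒ (mat A B C D) eq = ℤ.+-injective (begin
    + (A * D)                                      ≡⟨ ℤ.pos-* A D ⟩
    + A ℤ.* + D                                    ≡⟨ move (+ A ℤ.* + D) (+ B ℤ.* + C) ⟩
    + A ℤ.* + D ℤ.- + B ℤ.* + C ℤ.+ + B ℤ.* + C    ≡⟨ cong₂ ℤ._+_ eq (sym (ℤ.pos-* B C)) ⟩
    + (1 + B * C)                                  ∎)
    where
    open ≡-Reasoning
    move : ∀ i j → i ≡ i ℤ.- j ℤ.+ j
    move = ℤ-Solver.solve-∀

  det≡-1⇒ : ∀ M → det M ≡ ℤ.- + 1 → B M * C M ≡ 1 + A M * D M
  det≡-1⇒ (mat A B C D) eq = det≡1⇒ (mat B A D C) (trans (swap (+ A) (+ B) (+ C) (+ D)) (cong ℤ.-_ eq))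
    where
    swap : ∀ x y z w → y ℤ.* z ℤ.- x ℤ.* w ≡ ℤ.- (x ℤ.* w ℤ.- y ℤ.* z)
    swap = ℤ-Solver.solve-∀

  cancel-det : ∀ {t s i j} → t + 2 * i ≡ s + 2 * j → i ≡ 1 + j → t + 2 ≡ s
  cancel-det {t} {s} {j = j} eq refl = ℕ.+-cancelʳ-≡ (2 * j) (t + 2) s (trans (regroup t j) eq)
    where
    regroup : ∀ t j → t + 2 + 2 * j ≡ t + 2 * (1 + j)
    regroup = ℕ-Solver.solve-∀

  foldedᵒ : ∀ U → det U ≡ ℤ.- + 1 → FoldedMatrix (sumEntries U) (foldMat (addRows (addCols U)) U)
  foldedᵒ U det≡-1 = record
    { trace≡ = cancel-det (trace-foldMatᵒ U) (det≡-1⇒ U det≡-1)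
    ; C≡     = C-foldMatᵒ U
    ; det≡   = trans (det-foldMat (addRows (addCols U)) U)
        (cong₂ ℤ._*_ (trans (det-addRows (addCols U)) (trans (det-addCols U) det≡-1)) det≡-1)
    }

  -- The even case comes from the odd one by splitting the last digit d into d - 1, 1. The lowered
  -- copy of that 1 is a 0, and the digits 1, 0, d - 1 after the centre collapse to d. So the last
  -- digit is lowered in the first copy and not in the reversed one.
  foldedᵉ : ∀ U → det U ≡ + 1 → FoldedMatrix (sumEntries U) (foldMat (addRows U) (addCols U))
  foldedᵉ U det≡1 = record
    { trace≡ = cancel-det (trace-foldMatᵉ U) (det≡1⇒ U det≡1)
    ; C≡     = C-foldMatᵉ U
    ; det≡   = trans (det-foldMat (addRows U) (addCols U))
        (cong₂ ℤ._*_ (trans (det-addRows U) det≡1) (trans (det-addCols U) det≡1))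
    }

  module _ {m : ℕ} where

    between-mono : ∀ {i} → Between1And m i → Between1And (suc m) i
    between-mono (1≤i , i≤m) = 1≤i , ℕ.m≤n⇒m≤1+n i≤m

    between-suc : ∀ {i} → Between1And m i → Between1And (suc m) (suc i)
    between-suc (_ , i≤m) = s≤s z≤n , s≤s i≤m

    1-between : Between1And (suc m) 1
    1-between = s≤s z≤n , s≤s z≤n

    digits-folded : ∀ {as bs} → All (Between1And (suc m)) as → All (Between1And (suc m)) bs →
                    All (Between1And (suc m)) (foldedTail as bs)
    digits-folded as≤ bs≤ =
      All.++⁺ as≤ (1-between ∷ 1-between ∷ All.∷ʳ⁺ (All-reverse bs≤) 1-between)

    foldedPeriod : ∀ {as} → All (Between1And m) as → m + 2 < continuant as →
      ∃[ bs ] All (Between1And (suc m)) bs × FoldedMatrix (continuant as) ⟦ 1 ∷ bs ⟧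
    -- The sign of this determinant is the parity of the length of the normalised word, which
    -- decides how to fold.
    foldedPeriod {as} as≤m large = fold (det-⟦⟧ (a ∷ mid ∷ʳ b))
      where
      normalised = normalise as≤m large
      a b : ℕ
      a = proj₁ normalised
      b = proj₁ (proj₂ normalised)
      mid : List ℕ
      mid = proj₁ (proj₂ (proj₂ normalised))
      bounds : Between1And m a × Between1And m b × Digits mid × continuant (suc a ∷ mid ∷ʳ suc b) ≡ continuant as
      bounds = proj₂ (proj₂ (proj₂ normalised))
      a≤m = proj₁ bounds
      b≤m = proj₁ (proj₂ bounds)
      mid≤ : All (Between1And (suc m)) mid
      mid≤ = All.map between-mono (proj₁ (proj₂ (proj₂ bounds)))
      U : Mat
      U = ⟦ a ∷ mid ∷ʳ b ⟧
      ⟦both⟧ : ⟦ suc a ∷ mid ∷ʳ suc b ⟧ ≡ addRows (addCols U)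
      ⟦both⟧ = trans (⟦suc∷⟧ a (mid ∷ʳ suc b)) (cong addRows (⟦∷ʳsuc⟧ (a ∷ mid) b))
      sum≡ : sumEntries U ≡ continuant as
      sum≡ = trans (sym (cong A ⟦both⟧)) (proj₂ (proj₂ (proj₂ bounds)))
      transport : ∀ {M N} → M ≡ N → FoldedMatrix (sumEntries U) N → FoldedMatrix (continuant as) M
      transport refl = subst (λ q → FoldedMatrix q _) sum≡
      fold : det U ≡ + 1 ⊎ det U ≡ ℤ.- + 1 →
        ∃[ bs ] All (Between1And (suc m)) bs × FoldedMatrix (continuant as) ⟦ 1 ∷ bs ⟧
      fold (inj₁ det≡1) = foldedTail (suc a ∷ mid ∷ʳ b) (a ∷ mid ∷ʳ suc b) ,
        digits-folded (between-suc a≤m ∷ All.∷ʳ⁺ mid≤ (between-mono b≤m))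
                      (between-mono a≤m ∷ All.∷ʳ⁺ mid≤ (between-suc b≤m)) ,
        transport (trans (⟦folded⟧ (suc a ∷ mid ∷ʳ b) (a ∷ mid ∷ʳ suc b))
                         (cong₂ foldMat (⟦suc∷⟧ a (mid ∷ʳ b)) (⟦∷ʳsuc⟧ (a ∷ mid) b)))
                  (foldedᵉ U det≡1)
      fold (inj₂ det≡-1) = foldedTail (suc a ∷ mid ∷ʳ suc b) (a ∷ mid ∷ʳ b) ,
        digits-folded (between-suc a≤m ∷ All.∷ʳ⁺ mid≤ (between-suc b≤m))
                      (between-mono a≤m ∷ All.∷ʳ⁺ mid≤ (between-mono b≤m)) ,
        transport (trans (⟦folded⟧ (suc a ∷ mid ∷ʳ suc b) (a ∷ mid ∷ʳ b))
                         (cong (λ M → foldMat M U) ⟦both⟧))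
                  (foldedᵒ U det≡-1)

-- Integers in ℚ, and numbers (x + y √δ) / n with integer x and y

module Rationals where
  open ℚ-Solver.+-*-Solver

  ι : ℤ → ℚ
  ι i = i ℚ./ 1

  toℚᵘ-/ : ∀ i n .{{_ : ℕ.NonZero n}} → toℚᵘ (i ℚ./ n) ℚᵘ.≃ i ℚᵘ./ n
  toℚᵘ-/ i (suc n) = ℚ.toℚᵘ-fromℚᵘ (mkℚᵘ i n)

  ι-+ : ∀ i j → ι (i ℤ.+ j) ≡ ι i ℚ.+ ι j
  ι-+ i j = ℚ.toℚᵘ-injective (begin
    toℚᵘ (ι (i ℤ.+ j))             ≈⟨ toℚᵘ-/ (i ℤ.+ j) 1 ⟩
    (i ℤ.+ j) ℚᵘ./ 1               ≈⟨ *≡* (identity i j) ⟩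
    (i ℚᵘ./ 1) ℚᵘ.+ (j ℚᵘ./ 1)     ≈⟨ ℚᵘ.+-cong (toℚᵘ-/ i 1) (toℚᵘ-/ j 1) ⟨
    toℚᵘ (ι i) ℚᵘ.+ toℚᵘ (ι j)     ≈⟨ ℚ.toℚᵘ-homo-+ (ι i) (ι j) ⟨
    toℚᵘ (ι i ℚ.+ ι j)             ∎)
    where
    open ℚᵘ.≃-Reasoning
    identity : ∀ i j → (i ℤ.+ j) ℤ.* + 1 ≡ (i ℤ.* + 1 ℤ.+ j ℤ.* + 1) ℤ.* + 1
    identity = ℤ-Solver.solve-∀

  ι-* : ∀ i j → ι (i ℤ.* j) ≡ ι i ℚ.* ι j
  ι-* i j = ℚ.toℚᵘ-injective (begin
    toℚᵘ (ι (i ℤ.* j))             ≈⟨ toℚᵘ-/ (i ℤ.* j) 1 ⟩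
    (i ℤ.* j) ℚᵘ./ 1               ≈⟨ *≡* refl ⟩
    (i ℚᵘ./ 1) ℚᵘ.* (j ℚᵘ./ 1)     ≈⟨ ℚᵘ.*-cong (toℚᵘ-/ i 1) (toℚᵘ-/ j 1) ⟨
    toℚᵘ (ι i) ℚᵘ.* toℚᵘ (ι j)     ≈⟨ ℚ.toℚᵘ-homo-* (ι i) (ι j) ⟨
    toℚᵘ (ι i ℚ.* ι j)             ∎)
    where open ℚᵘ.≃-Reasoning

  ι-neg : ∀ i → ι (ℤ.- i) ≡ ℚ.- ι i
  ι-neg i = ℚ.toℚᵘ-injective (begin
    toℚᵘ (ι (ℤ.- i))               ≈⟨ toℚᵘ-/ (ℤ.- i) 1 ⟩
    (ℤ.- i) ℚᵘ./ 1                 ≈⟨ ℚᵘ.-‿cong (toℚᵘ-/ i 1) ⟨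
    ℚᵘ.- toℚᵘ (ι i)                ≈⟨ ℚ.toℚᵘ-homo‿- (ι i) ⟨
    toℚᵘ (ℚ.- ι i)                 ∎)
    where open ℚᵘ.≃-Reasoning

  ι-sub : ∀ i j → ι (i ℤ.- j) ≡ ι i ℚ.- ι j
  ι-sub i j = trans (ι-+ i (ℤ.- j)) (cong (ι i ℚ.+_) (ι-neg j))

  ι-injective : ∀ {i j} → ι i ≡ ι j → i ≡ j
  ι-injective {i} {j} eq = ℤ.*-cancelʳ-≡ i j (+ 1) (ℚᵘ.drop-*≡*
    (ℚᵘ.≃-trans (ℚᵘ.≃-sym (toℚᵘ-/ i 1)) (ℚᵘ.≃-trans (ℚᵘ.≃-reflexive (cong toℚᵘ eq)) (toℚᵘ-/ j 1))))

  ι-mono-< : ∀ {i j} → i ℤ.< j → ι i ℚ.< ι j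
  ι-mono-< {i} {j} i<j = ℚ.toℚᵘ-cancel-< (ℚᵘ.<-respʳ-≃ (ℚᵘ.≃-sym (toℚᵘ-/ j 1))
    (ℚᵘ.<-respˡ-≃ (ℚᵘ.≃-sym (toℚᵘ-/ i 1)) (*<* (ℤ.*-monoʳ-<-pos (+ 1) i<j))))

  /-* : ∀ i n .{{_ : ℕ.NonZero n}} → (i ℚ./ n) ℚ.* ι (+ n) ≡ ι i
  /-* i (suc n) = ℚ.toℚᵘ-injective (begin
    toℚᵘ ((i ℚ./ suc n) ℚ.* ι (+ suc n))              ≈⟨ ℚ.toℚᵘ-homo-* (i ℚ./ suc n) (ι (+ suc n)) ⟩
    toℚᵘ (i ℚ./ suc n) ℚᵘ.* toℚᵘ (ι (+ suc n))        ≈⟨ ℚᵘ.*-cong (toℚᵘ-/ i (suc n)) (toℚᵘ-/ (+ suc n) 1) ⟩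
    mkℚᵘ i n ℚᵘ.* mkℚᵘ (+ suc n) 0                    ≈⟨ *≡* (trans (ℤ.*-identityʳ _) (cong (λ k → i ℤ.* + k) (sym (ℕ.*-identityʳ (suc n))))) ⟩
    mkℚᵘ i 0                                          ≈⟨ toℚᵘ-/ i 1 ⟨
    toℚᵘ (ι i)                                        ∎)
    where open ℚᵘ.≃-Reasoning

  -- 1/n, with the junk value 1 at n = 0
  recip : ℕ → ℚ
  recip n = + 1 ℚ./ suc (ℕ.pred n)

  *-recip : ∀ {n} → 0 ℕ.< n → ι (+ n) ℚ.* recip n ≡ 1ℚ
  *-recip {suc n} _ = trans (ℚ.*-comm (ι (+ suc n)) (recip (suc n))) (/-* (+ 1) (suc n))

  0<recip : ∀ n → 0ℚ ℚ.< recip n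
  0<recip n = ℚ.toℚᵘ-cancel-< (ℚᵘ.<-respʳ-≃ (ℚᵘ.≃-sym (toℚᵘ-/ (+ 1) (suc (ℕ.pred n)))) (*<* (ℤ.+<+ (s≤s z≤n))))

  0<p*q : ∀ {p q} → 0ℚ ℚ.< p → 0ℚ ℚ.< q → 0ℚ ℚ.< p ℚ.* q
  0<p*q {p} {q} 0<p 0<q = subst (ℚ._< p ℚ.* q) (ℚ.*-zeroˡ q) (ℚ.*-monoˡ-<-pos q {{ℚ.positive 0<q}} 0<p)

  module _ {δ : ℕ} where

    _+_√δ/_ : ℤ → ℤ → ℕ → ℚ[√ δ ]
    x + y √δ/ n = (ι x ℚ.* recip n) + (ι y ℚ.* recip n) √δ

    private
      square : ∀ x n → ι (x ℤ.* x) ℚ.* (recip n ℚ.* recip n) ≡ (ι x ℚ.* recip n) ℚ.* (ι x ℚ.* recip n)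
      square x n = trans (cong (ℚ._* (recip n ℚ.* recip n)) (ι-* x x)) (lemma (ι x) (recip n))
        where
        lemma : ∀ x r → (x ℚ.* x) ℚ.* (r ℚ.* r) ≡ (x ℚ.* r) ℚ.* (x ℚ.* r)
        lemma = solve 2 (λ x r → (x :* x) :* (r :* r) := (x :* r) :* (x :* r)) refl

      δ-square : ∀ y n → ι (+ δ ℤ.* (y ℤ.* y)) ℚ.* (recip n ℚ.* recip n)
                         ≡ fromℕ δ ℚ.* ((ι y ℚ.* recip n) ℚ.* (ι y ℚ.* recip n))
      δ-square y n = begin
        ι (+ δ ℤ.* (y ℤ.* y)) ℚ.* (recip n ℚ.* recip n)           ≡⟨ cong (ℚ._* (recip n ℚ.* recip n)) (ι-* (+ δ) (y ℤ.* y)) ⟩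
        fromℕ δ ℚ.* ι (y ℤ.* y) ℚ.* (recip n ℚ.* recip n)         ≡⟨ ℚ.*-assoc (fromℕ δ) (ι (y ℤ.* y)) _ ⟩
        fromℕ δ ℚ.* (ι (y ℤ.* y) ℚ.* (recip n ℚ.* recip n))       ≡⟨ cong (fromℕ δ ℚ.*_) (square y n) ⟩
        fromℕ δ ℚ.* ((ι y ℚ.* recip n) ℚ.* (ι y ℚ.* recip n))     ∎
        where open ≡-Reasoning

      scale-< : ∀ {i j} n → i ℤ.< j → ι i ℚ.* (recip n ℚ.* recip n) ℚ.< ι j ℚ.* (recip n ℚ.* recip n)
      scale-< n i<j = ℚ.*-monoˡ-<-pos (recip n ℚ.* recip n) {{ℚ.positive (0<p*q (0<recip n) (0<recip n))}} (ι-mono-< i<j)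

    positive-re : ∀ x y n → + 0 ℤ.< x → + δ ℤ.* (y ℤ.* y) ℤ.< x ℤ.* x → Positiveᴷ (x + y √δ/ n)
    positive-re x y n 0<x δy²<x² = inj₁
      ( 0<p*q (ι-mono-< 0<x) (0<recip n)
      , subst₂ ℚ._<_ (δ-square y n) (square x n) (scale-< n δy²<x²))

    positive-im : ∀ x y n → + 0 ℤ.< y → x ℤ.* x ℤ.< + δ ℤ.* (y ℤ.* y) → Positiveᴷ (x + y √δ/ n)
    positive-im x y n 0<y x²<δy² = inj₂
      ( 0<p*q (ι-mono-< 0<y) (0<recip n)
      , subst₂ ℚ._<_ (square x n) (δ-square y n) (scale-< n x²<δy²))

    √δ-≡ : ∀ {a a′ b b′ : ℚ} → a ≡ a′ → b ≡ b′ → _≡_ {A = ℚ[√ δ ]} (a + b √δ) (a′ + b′ √δ)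
    √δ-≡ refl refl = refl

    fromℕ-/ : ∀ k {n} → 0 ℕ.< n → fromℕ k ≡ ι (+ n ℤ.* + k) ℚ.* recip n
    fromℕ-/ k {n} 0<n = sym (begin
      ι (+ n ℤ.* + k) ℚ.* recip n        ≡⟨ cong (ℚ._* recip n) (ι-* (+ n) (+ k)) ⟩
      ι (+ n) ℚ.* ι (+ k) ℚ.* recip n    ≡⟨ rearrange (ι (+ n)) (ι (+ k)) (recip n) ⟩
      ι (+ n) ℚ.* recip n ℚ.* ι (+ k)    ≡⟨ cong (ℚ._* ι (+ k)) (*-recip 0<n) ⟩
      1ℚ ℚ.* ι (+ k)                     ≡⟨ ℚ.*-identityˡ (ι (+ k)) ⟩
      ι (+ k)                            ∎)
      where
      open ≡-Reasoning
      rearrange : ∀ x y r → x ℚ.* y ℚ.* r ≡ x ℚ.* r ℚ.* y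
      rearrange = solve 3 (λ x y r → x :* y :* r := x :* r :* y) refl

    sub-/ : ∀ x y r → ι (x ℤ.- y) ℚ.* r ≡ ι x ℚ.* r ℚ.- ι y ℚ.* r
    sub-/ x y r = trans (cong (ℚ._* r) (ι-sub x y)) (distrib (ι x) (ι y) r)
      where
      distrib : ∀ x y r → (x ℚ.- y) ℚ.* r ≡ x ℚ.* r ℚ.- y ℚ.* r
      distrib = solve 3 (λ x y r → (x :- y) :* r := x :* r :- y :* r) refl

    -natᴷ : ∀ x y {n} k → 0 ℕ.< n → x + y √δ/ n -ᴷ natᴷ k ≡ (x ℤ.- + n ℤ.* + k) + y √δ/ n
    -natᴷ x y {n} k 0<n = √δ-≡
      (trans (cong (λ z → ι x ℚ.* recip n ℚ.- z) (fromℕ-/ k 0<n)) (sym (sub-/ x (+ n ℤ.* + k) (recip n))))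
      (ℚ.+-identityʳ (ι y ℚ.* recip n))

    natᴷ- : ∀ x y {n} k → 0 ℕ.< n → natᴷ k -ᴷ x + y √δ/ n ≡ (+ n ℤ.* + k ℤ.- x) + (ℤ.- y) √δ/ n
    natᴷ- x y {n} k 0<n = √δ-≡
      (trans (cong (λ z → z ℚ.- ι x ℚ.* recip n) (fromℕ-/ k 0<n)) (sym (sub-/ (+ n ℤ.* + k) x (recip n))))
      (trans (ℚ.+-identityˡ (ℚ.- (ι y ℚ.* recip n)))
        (trans (ℚ.neg-distribˡ-* (ι y) (recip n)) (cong (ℚ._* recip n) (sym (ι-neg y)))))

    -- A difference of squares: (y √δ - x) (y √δ + x) = δ y² - x² = n k. It explains why successive
    -- complete quotients share the same y.
    conjugate-inverse : ∀ x y {n k} → 0 ℕ.< n → 0 ℕ.< k →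
      + δ ℤ.* (y ℤ.* y) ≡ x ℤ.* x ℤ.+ + n ℤ.* + k →
      (ℤ.- x) + y √δ/ n *ᴷ x + y √δ/ k ≡ 1ᴷ
    conjugate-inverse x y {n} {k} 0<n 0<k norm = √δ-≡ re≡1 im≡0
      where
      open ≡-Reasoning
      N = recip n
      K = recip k
      rearrange : ∀ x y d N K → (ℚ.- x ℚ.* N) ℚ.* (x ℚ.* K) ℚ.+ d ℚ.* ((y ℚ.* N) ℚ.* (y ℚ.* K))
                  ≡ (d ℚ.* (y ℚ.* y) ℚ.- x ℚ.* x) ℚ.* (N ℚ.* K)
      rearrange = solve 5 (λ x y d N K → (:- x :* N) :* (x :* K) :+ d :* ((y :* N) :* (y :* K))
                  := (d :* (y :* y) :- x :* x) :* (N :* K)) refl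
      norm′ : fromℕ δ ℚ.* (ι y ℚ.* ι y) ℚ.- ι x ℚ.* ι x ≡ ι (+ n) ℚ.* ι (+ k)
      norm′ = begin
        fromℕ δ ℚ.* (ι y ℚ.* ι y) ℚ.- ι x ℚ.* ι x                 ≡⟨ cong (λ z → fromℕ δ ℚ.* z ℚ.- ι x ℚ.* ι x) (ι-* y y) ⟨
        fromℕ δ ℚ.* ι (y ℤ.* y) ℚ.- ι x ℚ.* ι x                   ≡⟨ cong₂ ℚ._-_ (ι-* (+ δ) (y ℤ.* y)) (ι-* x x) ⟨
        ι (+ δ ℤ.* (y ℤ.* y)) ℚ.- ι (x ℤ.* x)                     ≡⟨ ι-sub (+ δ ℤ.* (y ℤ.* y)) (x ℤ.* x) ⟨
        ι (+ δ ℤ.* (y ℤ.* y) ℤ.- x ℤ.* x)                         ≡⟨ cong (λ z → ι (z ℤ.- x ℤ.* x)) norm ⟩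
        ι (x ℤ.* x ℤ.+ + n ℤ.* + k ℤ.- x ℤ.* x)                   ≡⟨ cong ι (cancel (x ℤ.* x) (+ n ℤ.* + k)) ⟩
        ι (+ n ℤ.* + k)                                           ≡⟨ ι-* (+ n) (+ k) ⟩
        ι (+ n) ℚ.* ι (+ k)                                       ∎
        where
        cancel : ∀ a b → a ℤ.+ b ℤ.- a ≡ b
        cancel = ℤ-Solver.solve-∀
      regroup : ∀ n k N K → (n ℚ.* k) ℚ.* (N ℚ.* K) ≡ (n ℚ.* N) ℚ.* (k ℚ.* K)
      regroup = solve 4 (λ n k N K → (n :* k) :* (N :* K) := (n :* N) :* (k :* K)) refl
      re≡1 = begin
        (ι (ℤ.- x) ℚ.* N) ℚ.* (ι x ℚ.* K) ℚ.+ fromℕ δ ℚ.* ((ι y ℚ.* N) ℚ.* (ι y ℚ.* K))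
          ≡⟨ cong (λ z → (z ℚ.* N) ℚ.* (ι x ℚ.* K) ℚ.+ fromℕ δ ℚ.* ((ι y ℚ.* N) ℚ.* (ι y ℚ.* K))) (ι-neg x) ⟩
        (ℚ.- ι x ℚ.* N) ℚ.* (ι x ℚ.* K) ℚ.+ fromℕ δ ℚ.* ((ι y ℚ.* N) ℚ.* (ι y ℚ.* K))
          ≡⟨ rearrange (ι x) (ι y) (fromℕ δ) N K ⟩
        (fromℕ δ ℚ.* (ι y ℚ.* ι y) ℚ.- ι x ℚ.* ι x) ℚ.* (N ℚ.* K)   ≡⟨ cong (ℚ._* (N ℚ.* K)) norm′ ⟩
        (ι (+ n) ℚ.* ι (+ k)) ℚ.* (N ℚ.* K)                         ≡⟨ regroup (ι (+ n)) (ι (+ k)) N K ⟩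
        (ι (+ n) ℚ.* N) ℚ.* (ι (+ k) ℚ.* K)                         ≡⟨ cong₂ ℚ._*_ (*-recip 0<n) (*-recip 0<k) ⟩
        1ℚ ∎
      vanish : ∀ x y N K → (ℚ.- x ℚ.* N) ℚ.* (y ℚ.* K) ℚ.+ (y ℚ.* N) ℚ.* (x ℚ.* K) ≡ 0ℚ
      vanish = solve 4 (λ x y N K → (:- x :* N) :* (y :* K) :+ (y :* N) :* (x :* K) := con 0ℚ) refl
      im≡0 = trans (cong (λ z → (z ℚ.* N) ℚ.* (ι y ℚ.* K) ℚ.+ (ι y ℚ.* N) ℚ.* (ι x ℚ.* K)) (ι-neg x))
                   (vanish (ι x) (ι y) N K)

open Pell
open Continuants
open Rationals

-- From Zaremba's conjecture to a continuant equal to q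

module Zaremba where

  value-⟦⟧ : ∀ {r as} → r ≡[ as ] → r ℚ.* ι (+ C ⟦ as ⟧) ≡ ι (+ A ⟦ as ⟧)
  value-⟦⟧ (last a) = trans (ℚ.*-identityʳ (fromℕ a)) (cong fromℕ (sym (trans (ℕ.+-identityʳ (a ℕ.* 1)) (ℕ.*-identityʳ a))))
  value-⟦⟧ (cons a {as} {r} r≡) = begin
    (fromℕ a ℚ.+ 1/r) ℚ.* ι (+ A₁)               ≡⟨ ℚ.*-distribʳ-+ (ι (+ A₁)) (fromℕ a) 1/r ⟩
    fromℕ a ℚ.* ι (+ A₁) ℚ.+ 1/r ℚ.* ι (+ A₁)    ≡⟨ cong₂ ℚ._+_ (sym (ι-* (+ a) (+ A₁))) 1/r*A₁≡C₁ ⟩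
    ι (+ a ℤ.* + A₁) ℚ.+ ι (+ C₁)                ≡⟨ ι-+ (+ a ℤ.* + A₁) (+ C₁) ⟨
    ι (+ a ℤ.* + A₁ ℤ.+ + C₁)                    ≡⟨ cong ι (+[m*n+o] a A₁ C₁) ⟨
    ι (+ (a ℕ.* A₁ ℕ.+ C₁))                      ∎
    where
    open ≡-Reasoning
    A₁ C₁ : ℕ
    A₁ = A ⟦ as ⟧
    C₁ = C ⟦ as ⟧
    1/r : ℚ
    1/r = ℚ.1/ r
    1/r*A₁≡C₁ : 1/r ℚ.* ι (+ A₁) ≡ ι (+ C₁)
    1/r*A₁≡C₁ = begin
      1/r ℚ.* ι (+ A₁)            ≡⟨ cong (1/r ℚ.*_) (value-⟦⟧ r≡) ⟨
      1/r ℚ.* (r ℚ.* ι (+ C₁))    ≡⟨ ℚ.*-assoc 1/r r (ι (+ C₁)) ⟨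
      1/r ℚ.* r ℚ.* ι (+ C₁)      ≡⟨ cong (ℚ._* ι (+ C₁)) (ℚ.*-inverseˡ r) ⟩
      1ℚ ℚ.* ι (+ C₁)             ≡⟨ ℚ.*-identityˡ (ι (+ C₁)) ⟩
      ι (+ C₁)                    ∎

  -- Both p / q and the quotient of the first column are in lowest terms; after cross multiplication
  -- each denominator divides the other.
  C⟦⟧≡denominator : ∀ {p q as} .{{_ : ℕ.NonZero q}} → ℤ.Coprime p (+ q) → (p ℚ./ q) ≡[ as ] → C ⟦ as ⟧ ≡ q
  C⟦⟧≡denominator {p} {q} {as} coprime p/q≡ = ℕ.∣-antisym
    (ℕ.coprime-divisor (ℕ.sym (coprime-columns as)) (ℕ.divides ∣ p ∣ (sym cross)))
    (ℕ.coprime-divisor (ℕ.sym coprime) (ℕ.divides (A ⟦ as ⟧) cross))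
    where
    open ≡-Reasoning
    P Q : ℕ
    P = A ⟦ as ⟧
    Q = C ⟦ as ⟧
    crossℤ : p ℤ.* + Q ≡ + P ℤ.* + q
    crossℤ = ι-injective (begin
      ι (p ℤ.* + Q)                               ≡⟨ ι-* p (+ Q) ⟩
      ι p ℚ.* ι (+ Q)                             ≡⟨ cong (ℚ._* ι (+ Q)) (/-* p q) ⟨
      (p ℚ./ q) ℚ.* ι (+ q) ℚ.* ι (+ Q)           ≡⟨ swap (p ℚ./ q) (ι (+ q)) (ι (+ Q)) ⟩
      (p ℚ./ q) ℚ.* ι (+ Q) ℚ.* ι (+ q)           ≡⟨ cong (ℚ._* ι (+ q)) (value-⟦⟧ p/q≡) ⟩
      ι (+ P) ℚ.* ι (+ q)                         ≡⟨ ι-* (+ P) (+ q) ⟨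
      ι (+ P ℤ.* + q)                             ∎)
      where
      open ℚ-Solver.+-*-Solver
      swap : ∀ x y z → x ℚ.* y ℚ.* z ≡ x ℚ.* z ℚ.* y
      swap = solve 3 (λ x y z → x :* y :* z := x :* z :* y) refl
    cross : ∣ p ∣ ℕ.* Q ≡ P ℕ.* q
    cross = begin
      ∣ p ∣ ℕ.* Q           ≡⟨ ℤ.abs-* p (+ Q) ⟨
      ∣ p ℤ.* + Q ∣         ≡⟨ cong ∣_∣ crossℤ ⟩
      ∣ + P ℤ.* + q ∣       ≡⟨ ℤ.abs-* (+ P) (+ q) ⟩
      P ℕ.* q               ∎

  -- The integer part a₀ does not affect the denominator: `C ⟦ a ∷ as ⟧` is by definition
  -- `A ⟦ as ⟧`, so a₀ is dropped.
  continuant≡denominator : ∀ {m p q as} .{{_ : ℕ.NonZero q}} → ℤ.Coprime p (+ q) →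
    (p ℚ./ q) ≡[ as ] → All (Between1And m) as → ∃[ bs ] All (Between1And m) bs × continuant bs ≡ q
  continuant≡denominator {p = p} {as = _ ∷ as} coprime p/q≡ (_ ∷ as≤m) = as , as≤m , C⟦⟧≡denominator {p} coprime p/q≡

-- One step of the expansion of a fixed point

module Expansion where

  0<i*j : ∀ {i j} → + 0 ℤ.< i → + 0 ℤ.< j → + 0 ℤ.< i ℤ.* j
  0<i*j {+ suc _} {+ suc _} _ _ = ℤ.+<+ (s≤s z≤n)
  0<i*j {+ zero}  (ℤ.+<+ ()) _
  0<i*j {+ suc _} {+ zero} _ (ℤ.+<+ ())

  i<i+j : ∀ i {j} → + 0 ℤ.< j → i ℤ.< i ℤ.+ j
  i<i+j i {j} 0<j = subst (ℤ._< i ℤ.+ j) (ℤ.+-identityʳ i) (ℤ.+-monoʳ-< i 0<j)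

  i<j⇒0<j-i : ∀ {i j} → i ℤ.< j → + 0 ℤ.< j ℤ.- i
  i<j⇒0<j-i {i} {j} i<j = subst (ℤ._< j ℤ.- i) (ℤ.+-inverseʳ i) (ℤ.+-monoˡ-< (ℤ.- i) i<j)

  append : Mat → ℕ → Mat
  append (mat A B C D) b = mat (A ℕ.* b ℕ.+ B) A (C ℕ.* b ℕ.+ D) C

  ⟦∷ʳ⟧ : ∀ as b → ⟦ as ∷ʳ b ⟧ ≡ append ⟦ as ⟧ b
  ⟦∷ʳ⟧ as b = trans (⟦⟧-++ as (b ∷ []))
    (mat-≡ (identity₁ b (A ⟦ as ⟧) (B ⟦ as ⟧)) (identity₂ b (A ⟦ as ⟧) (B ⟦ as ⟧))
           (identity₁ b (C ⟦ as ⟧) (D ⟦ as ⟧)) (identity₂ b (C ⟦ as ⟧) (D ⟦ as ⟧)))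
    where
    identity₁ : ∀ b x y → x ℕ.* (b ℕ.* 1 ℕ.+ 0) ℕ.+ y ℕ.* 1 ≡ x ℕ.* b ℕ.+ y
    identity₁ = ℕ-Solver.solve-∀
    identity₂ : ∀ b x y → x ℕ.* (b ℕ.* 0 ℕ.+ 1) ℕ.+ y ℕ.* 0 ≡ x
    identity₂ = ℕ-Solver.solve-∀

  disc : Mat → ℤ
  disc (mat A B C D) = (+ A ℤ.- + D) ℤ.* (+ A ℤ.- + D) ℤ.+ + 4 ℤ.* (+ B ℤ.* + C)

  -- The two matrices are conjugate by (b 1 ; 1 0), and `disc` is trace² - 4 det.
  disc-rotate : ∀ b M → disc (prepend b M) ≡ disc (append M b)
  disc-rotate b (mat A B C D) = begin
    disc (prepend b (mat A B C D))
      ≡⟨ cong₂ (λ i j → (i ℤ.- + B) ℤ.* (i ℤ.- + B) ℤ.+ + 4 ℤ.* (j ℤ.* + A)) (+[m*n+o] b A C) (+[m*n+o] b B D) ⟩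
    (+ b ℤ.* + A ℤ.+ + C ℤ.- + B) ℤ.* (+ b ℤ.* + A ℤ.+ + C ℤ.- + B) ℤ.+ + 4 ℤ.* ((+ b ℤ.* + B ℤ.+ + D) ℤ.* + A)
      ≡⟨ identity (+ b) (+ A) (+ B) (+ C) (+ D) ⟩
    (+ A ℤ.* + b ℤ.+ + B ℤ.- + C) ℤ.* (+ A ℤ.* + b ℤ.+ + B ℤ.- + C) ℤ.+ + 4 ℤ.* (+ A ℤ.* (+ C ℤ.* + b ℤ.+ + D))
      ≡⟨ cong₂ (λ i j → (i ℤ.- + C) ℤ.* (i ℤ.- + C) ℤ.+ + 4 ℤ.* (+ A ℤ.* j)) (+[m*n+o] A b B) (+[m*n+o] C b D) ⟨
    disc (append (mat A B C D) b) ∎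
    where
    open ≡-Reasoning
    identity : ∀ b x y z w →
      (b ℤ.* x ℤ.+ z ℤ.- y) ℤ.* (b ℤ.* x ℤ.+ z ℤ.- y) ℤ.+ + 4 ℤ.* ((b ℤ.* y ℤ.+ w) ℤ.* x)
      ≡ (x ℤ.* b ℤ.+ y ℤ.- z) ℤ.* (x ℤ.* b ℤ.+ y ℤ.- z) ℤ.+ + 4 ℤ.* (x ℤ.* (z ℤ.* b ℤ.+ w))
    identity = ℤ-Solver.solve-∀

  -- Inequalities that will place the fixed point between b and b + 1. As a Möbius map, M must send
  -- b + 1 above 1: for b = 1 this is `2C+D<`, and `C≤A` carries it to larger b. The empty word
  -- satisfies them too, which covers periods of a single digit.
  record Balanced (M : Mat) : Set where
    field
      0<A     : 0 ℕ.< A M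
      C≤A     : C M ℕ.≤ A M
      0<C+D   : 0 ℕ.< C M ℕ.+ D M
      2C+D<   : 2 ℕ.* C M ℕ.+ D M ℕ.< 2 ℕ.* A M ℕ.+ B M

  balanced : ∀ {as} → All (1 ℕ.≤_) as → Balanced ⟦ as ⟧
  balanced [] = record { 0<A = s≤s z≤n ; C≤A = z≤n ; 0<C+D = s≤s z≤n ; 2C+D< = s≤s (s≤s z≤n) }
  balanced (_∷_ {suc a} {as} _ 1≤as) = record
    { 0<A   = ℕ.<-≤-trans 0<A A≤
    ; C≤A   = A≤
    ; 0<C+D = ℕ.<-≤-trans 0<A (ℕ.m≤m+n (A M) (B M))
    ; 2C+D< = ℕ.<-≤-trans (ℕ.m<m+n (2 ℕ.* A M ℕ.+ B M) 0<rest) (ℕ.≤-reflexive (identity a (A M) (B M) (C M) (D M)))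
    }
    where
    M = ⟦ as ⟧
    open Balanced (balanced 1≤as)
    A≤ : A M ℕ.≤ suc a ℕ.* A M ℕ.+ C M
    A≤ = ℕ.≤-trans (ℕ.m≤m+n (A M) (a ℕ.* A M)) (ℕ.m≤m+n (suc a ℕ.* A M) (C M))
    rest : ℕ
    rest = C M ℕ.+ D M ℕ.+ (2 ℕ.* a ℕ.* A M ℕ.+ C M ℕ.+ a ℕ.* B M)
    0<rest : 0 ℕ.< rest
    0<rest = ℕ.<-≤-trans 0<C+D (ℕ.m≤m+n (C M ℕ.+ D M) _)
    identity : ∀ a x y z w → 2 ℕ.* x ℕ.+ y ℕ.+ (z ℕ.+ w ℕ.+ (2 ℕ.* a ℕ.* x ℕ.+ z ℕ.+ a ℕ.* y))
               ≡ 2 ℕ.* (suc a ℕ.* x ℕ.+ z) ℕ.+ (suc a ℕ.* y ℕ.+ w)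
    identity = ℕ-Solver.solve-∀

  module _ {δ : ℕ} (y : ℤ) where

    -- the larger fixed point of M, provided that disc M ≡ δ y² and y > 0
    fixedPoint : Mat → ℚ[√ δ ]
    fixedPoint M = (+ A M ℤ.- + D M) + y √δ/ (2 ℕ.* C M)

    -- The fixed points of `prepend b M` are the roots of P(t) = A t² + (B - b A - C) t - (b B + D).
    -- Here P(b) = - (C b + D) < 0, so b lies strictly between the roots.
    module Step {M : Mat} (M-balanced : Balanced M) {b : ℕ} (1≤b : 1 ℕ.≤ b)
                (norm : disc (append M b) ≡ + δ ℤ.* (y ℤ.* y)) where
      open Balanced M-balanced

      private
        A₁ B₁ C₁ D₁ C₂ : ℕ
        A₁ = A M
        B₁ = B M
        C₁ = C M
        D₁ = D M
        C₂ = C₁ ℕ.* b ℕ.+ D₁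

        x₂ : ℤ
        x₂ = + (A₁ ℕ.* b ℕ.+ B₁) ℤ.- + C₁

        0<2A : 0 ℕ.< 2 ℕ.* A₁
        0<2A = ℕ.<-≤-trans 0<A (ℕ.m≤m+n A₁ _)

        0<2C₂ : 0 ℕ.< 2 ℕ.* C₂
        0<2C₂ = ℕ.<-≤-trans (ℕ.<-≤-trans 0<C+D (ℕ.+-monoˡ-≤ D₁ (ℕ.m≤m*n C₁ b {{ℕ.>-nonZero 1≤b}}))) (ℕ.m≤m+n C₂ _)

        norm′ : + δ ℤ.* (y ℤ.* y) ≡ x₂ ℤ.* x₂ ℤ.+ + (2 ℕ.* A₁) ℤ.* + (2 ℕ.* C₂)
        norm′ = trans (sym norm) (cong (λ z → x₂ ℤ.* x₂ ℤ.+ z) (begin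
          + 4 ℤ.* (+ A₁ ℤ.* + C₂)                  ≡⟨ identity (+ A₁) (+ C₂) ⟩
          (+ 2 ℤ.* + A₁) ℤ.* (+ 2 ℤ.* + C₂)        ≡⟨ cong₂ ℤ._*_ (ℤ.pos-* 2 A₁) (ℤ.pos-* 2 C₂) ⟨
          + (2 ℕ.* A₁) ℤ.* + (2 ℕ.* C₂)            ∎))
          where
          open ≡-Reasoning
          identity : ∀ i j → + 4 ℤ.* (i ℤ.* j) ≡ (+ 2 ℤ.* i) ℤ.* (+ 2 ℤ.* j)
          identity = ℤ-Solver.solve-∀

      ξ-b : fixedPoint (prepend b M) -ᴷ natᴷ b ≡ (ℤ.- x₂) + y √δ/ (2 ℕ.* A₁)
      ξ-b = trans (-natᴷ (+ A (prepend b M) ℤ.- + D (prepend b M)) y b 0<2A) (cong (_+ y √δ/ (2 ℕ.* A₁)) (begin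
        + (b ℕ.* A₁ ℕ.+ C₁) ℤ.- + B₁ ℤ.- + (2 ℕ.* A₁) ℤ.* + b
          ≡⟨ cong₂ (λ i j → i ℤ.- + B₁ ℤ.- j ℤ.* + b) (+[m*n+o] b A₁ C₁) (ℤ.pos-* 2 A₁) ⟩
        + b ℤ.* + A₁ ℤ.+ + C₁ ℤ.- + B₁ ℤ.- + 2 ℤ.* + A₁ ℤ.* + b
          ≡⟨ identity (+ b) (+ A₁) (+ B₁) (+ C₁) ⟩
        ℤ.- (+ A₁ ℤ.* + b ℤ.+ + B₁ ℤ.- + C₁)
          ≡⟨ cong (λ i → ℤ.- (i ℤ.- + C₁)) (+[m*n+o] A₁ b B₁) ⟨
        ℤ.- x₂ ∎))
        where
        open ≡-Reasoning
        identity : ∀ b x y z → b ℤ.* x ℤ.+ z ℤ.- y ℤ.- + 2 ℤ.* x ℤ.* b ≡ ℤ.- (x ℤ.* b ℤ.+ y ℤ.- z)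
        identity = ℤ-Solver.solve-∀

      inverse : (fixedPoint (prepend b M) -ᴷ natᴷ b) *ᴷ fixedPoint (append M b) ≡ 1ᴷ
      inverse = trans (cong (_*ᴷ fixedPoint (append M b)) ξ-b) (conjugate-inverse {δ} x₂ y 0<2A 0<2C₂ norm′)

      b<ξ : + 0 ℤ.< y → natᴷ b <ᴷ fixedPoint (prepend b M)
      b<ξ 0<y = subst Positiveᴷ (sym ξ-b) (positive-im {δ} (ℤ.- x₂) y (2 ℕ.* A₁) 0<y
        (subst₂ ℤ._<_ (neg-square x₂) (sym norm′)
          (i<i+j (x₂ ℤ.* x₂) (0<i*j {+ (2 ℕ.* A₁)} {+ (2 ℕ.* C₂)} (ℤ.+<+ 0<2A) (ℤ.+<+ 0<2C₂)))))
        where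
        neg-square : ∀ i → i ℤ.* i ≡ ℤ.- i ℤ.* ℤ.- i
        neg-square = ℤ-Solver.solve-∀

      private
        -- `gap` is P(b + 1) and `X` is the derivative P′(b + 1). Since X² equals the discriminant
        -- plus 4 A P(b + 1), positivity of both puts b + 1 beyond the larger root.
        X gap : ℤ
        X = + (A₁ ℕ.* b ℕ.+ B₁ ℕ.+ 2 ℕ.* A₁) ℤ.- + C₁
        gap = + (A₁ ℕ.* b ℕ.+ B₁ ℕ.+ A₁) ℤ.- + (C₁ ℕ.+ C₂)

        0<X : + 0 ℤ.< X
        0<X = i<j⇒0<j-i (ℤ.+<+ (ℕ.≤-<-trans C≤A (ℕ.<-≤-trans (ℕ.m<m+n A₁ 0<A)
          (ℕ.≤-trans (ℕ.≤-reflexive (cong (A₁ ℕ.+_) (sym (ℕ.+-identityʳ A₁)))) (ℕ.m≤n+m (2 ℕ.* A₁) (A₁ ℕ.* b ℕ.+ B₁))))))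

        0<gap : + 0 ℤ.< gap
        0<gap = i<j⇒0<j-i (ℤ.+<+ (go 1≤b))
          where
          identityˡ : ∀ b z w → b ℕ.* z ℕ.+ (2 ℕ.* z ℕ.+ w) ≡ z ℕ.+ (z ℕ.* suc b ℕ.+ w)
          identityˡ = ℕ-Solver.solve-∀
          identityʳ : ∀ b x y → b ℕ.* x ℕ.+ (2 ℕ.* x ℕ.+ y) ≡ x ℕ.* suc b ℕ.+ y ℕ.+ x
          identityʳ = ℕ-Solver.solve-∀
          go : ∀ {b} → 1 ℕ.≤ b → C₁ ℕ.+ (C₁ ℕ.* b ℕ.+ D₁) ℕ.< A₁ ℕ.* b ℕ.+ B₁ ℕ.+ A₁
          go {suc b} _ = subst₂ ℕ._<_ (identityˡ b C₁ D₁) (identityʳ b A₁ B₁)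
            (ℕ.+-mono-≤-< (ℕ.*-monoʳ-≤ b C≤A) 2C+D<)

      1+b-ξ : natᴷ (suc b) -ᴷ fixedPoint (prepend b M) ≡ X + (ℤ.- y) √δ/ (2 ℕ.* A₁)
      1+b-ξ = trans (natᴷ- (+ A (prepend b M) ℤ.- + D (prepend b M)) y (suc b) 0<2A)
        (cong (_+ (ℤ.- y) √δ/ (2 ℕ.* A₁)) (begin
        + (2 ℕ.* A₁) ℤ.* + suc b ℤ.- (+ (b ℕ.* A₁ ℕ.+ C₁) ℤ.- + B₁)
          ≡⟨ cong₂ (λ i j → i ℤ.* + suc b ℤ.- (j ℤ.- + B₁)) (ℤ.pos-* 2 A₁) (+[m*n+o] b A₁ C₁) ⟩
        (+ 2 ℤ.* + A₁) ℤ.* (+ 1 ℤ.+ + b) ℤ.- (+ b ℤ.* + A₁ ℤ.+ + C₁ ℤ.- + B₁)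
          ≡⟨ identity (+ b) (+ A₁) (+ B₁) (+ C₁) ⟩
        + A₁ ℤ.* + b ℤ.+ + B₁ ℤ.+ + 2 ℤ.* + A₁ ℤ.- + C₁
          ≡⟨ cong₂ (λ i j → i ℤ.+ j ℤ.- + C₁) (+[m*n+o] A₁ b B₁) (ℤ.pos-* 2 A₁) ⟨
        X ∎))
        where
        open ≡-Reasoning
        identity : ∀ b x y z → (+ 2 ℤ.* x) ℤ.* (+ 1 ℤ.+ b) ℤ.- (b ℤ.* x ℤ.+ z ℤ.- y)
                   ≡ x ℤ.* b ℤ.+ y ℤ.+ + 2 ℤ.* x ℤ.- z
        identity = ℤ-Solver.solve-∀

      ξ<1+b : fixedPoint (prepend b M) <ᴷ natᴷ (suc b)
      ξ<1+b = subst Positiveᴷ (sym 1+b-ξ) (positive-re {δ} X (ℤ.- y) (2 ℕ.* A₁) 0<X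
        (subst₂ ℤ._<_ (neg-square (+ δ) y) X² (i<i+j (+ δ ℤ.* (y ℤ.* y)) (0<i*j {+ 4} {+ A₁ ℤ.* gap} (ℤ.+<+ (s≤s z≤n)) (0<i*j {+ A₁} {gap} (ℤ.+<+ 0<A) 0<gap)))))
        where
        open ≡-Reasoning
        neg-square : ∀ d i → d ℤ.* (i ℤ.* i) ≡ d ℤ.* (ℤ.- i ℤ.* ℤ.- i)
        neg-square = ℤ-Solver.solve-∀
        identity : ∀ t x z w → (t ℤ.- z) ℤ.* (t ℤ.- z) ℤ.+ + 4 ℤ.* (x ℤ.* w) ℤ.+ + 4 ℤ.* (x ℤ.* (t ℤ.+ x ℤ.- (z ℤ.+ w)))
                   ≡ (t ℤ.+ + 2 ℤ.* x ℤ.- z) ℤ.* (t ℤ.+ + 2 ℤ.* x ℤ.- z)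
        identity = ℤ-Solver.solve-∀
        X² : + δ ℤ.* (y ℤ.* y) ℤ.+ + 4 ℤ.* (+ A₁ ℤ.* gap) ≡ X ℤ.* X
        X² = begin
          + δ ℤ.* (y ℤ.* y) ℤ.+ + 4 ℤ.* (+ A₁ ℤ.* gap)      ≡⟨ cong (ℤ._+ + 4 ℤ.* (+ A₁ ℤ.* gap)) norm ⟨
          disc (append M b) ℤ.+ + 4 ℤ.* (+ A₁ ℤ.* gap)      ≡⟨ identity (+ (A₁ ℕ.* b ℕ.+ B₁)) (+ A₁) (+ C₁) (+ C₂) ⟩
          (+ (A₁ ℕ.* b ℕ.+ B₁) ℤ.+ + 2 ℤ.* + A₁ ℤ.- + C₁) ℤ.* (+ (A₁ ℕ.* b ℕ.+ B₁) ℤ.+ + 2 ℤ.* + A₁ ℤ.- + C₁)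
            ≡⟨ cong (λ i → (+ (A₁ ℕ.* b ℕ.+ B₁) ℤ.+ i ℤ.- + C₁) ℤ.* (+ (A₁ ℕ.* b ℕ.+ B₁) ℤ.+ i ℤ.- + C₁)) (ℤ.pos-* 2 A₁) ⟨
          X ℤ.* X ∎

  -- Rotations of the period and pure periodicity

  rotate : List ℕ → List ℕ
  rotate []       = []
  rotate (a ∷ as) = as ∷ʳ a

  rotations : ℕ → List ℕ → List ℕ
  rotations zero    as = as
  rotations (suc n) as = rotations n (rotate as)

  rotations-suc : ∀ n as → rotations (suc n) as ≡ rotate (rotations n as)
  rotations-suc zero    as = refl
  rotations-suc (suc n) as = rotations-suc n (rotate as)

  rotations-+ : ∀ m n as → rotations (m ℕ.+ n) as ≡ rotations n (rotations m as)
  rotations-+ zero    n as = refl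
  rotations-+ (suc m) n as = rotations-+ m n (rotate as)

  -- The second list makes the induction work: it collects the digits already moved to the back.
  rotations-++ : ∀ as bs → rotations (length as) (as ++ bs) ≡ bs ++ as
  rotations-++ []       bs = sym (List.++-identityʳ bs)
  rotations-++ (a ∷ as) bs = begin
    rotations (length as) ((as ++ bs) ∷ʳ a)    ≡⟨ cong (rotations (length as)) (List.++-assoc as bs (a ∷ [])) ⟩
    rotations (length as) (as ++ (bs ∷ʳ a))    ≡⟨ rotations-++ as (bs ∷ʳ a) ⟩
    (bs ∷ʳ a) ++ as                            ≡⟨ List.∷ʳ-++ bs a as ⟩
    bs ++ (a ∷ as)                             ∎
    where open ≡-Reasoning

  rotations-length : ∀ as → rotations (length as) as ≡ as
  rotations-length as = trans (cong (rotations (length as)) (sym (List.++-identityʳ as))) (rotations-++ as [])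

  -- The first partial quotient, with the junk value 0 on the empty list.
  digit : List ℕ → ℕ
  digit []      = 0
  digit (a ∷ _) = a

  module _ {m : ℕ} {δ : ℕ} (y : ℤ) where

    -- The invariant of rotation: a nonempty bounded word whose discriminant is δ y² for one fixed
    -- y. All complete quotients thus lie in the same field with the same numerator y of √δ.
    data Admissible : List ℕ → Set where
      admissible : ∀ {a as} → All (Between1And m) (a ∷ as) →
                   disc ⟦ a ∷ as ⟧ ≡ + δ ℤ.* (y ℤ.* y) → Admissible (a ∷ as)

    disc-rotated : ∀ a as → disc ⟦ as ∷ʳ a ⟧ ≡ disc ⟦ a ∷ as ⟧
    disc-rotated a as = trans (cong disc (⟦∷ʳ⟧ as a)) (sym (disc-rotate a ⟦ as ⟧))

    rotate-admissible : ∀ {as} → Admissible as → Admissible (rotate as)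
    rotate-admissible (admissible {a} {[]} as≤m norm) = admissible as≤m norm
    rotate-admissible (admissible {a} {b ∷ bs} (a≤m ∷ as≤m) norm) =
      admissible (All.∷ʳ⁺ as≤m a≤m) (trans (disc-rotated a (b ∷ bs)) norm)

    rotations-admissible : ∀ n {as} → Admissible as → Admissible (rotations n as)
    rotations-admissible zero    h = h
    rotations-admissible (suc n) h = rotations-admissible n (rotate-admissible h)

    digit-bounded : ∀ {as} → Admissible as → Between1And m (digit as)
    digit-bounded (admissible (a≤m ∷ _) _) = a≤m

    module _ (0<y : + 0 ℤ.< y) where

      value : List ℕ → ℚ[√ δ ]
      value as = fixedPoint y ⟦ as ⟧

      first-step : ∀ {as} → Admissible as →
        natᴷ (digit as) <ᴷ value as × value as <ᴷ natᴷ (suc (digit as)) ×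
        (value as -ᴷ natᴷ (digit as)) *ᴷ value (rotate as) ≡ 1ᴷ
      first-step (admissible {a} {as} (a≤m ∷ as≤m) norm) =
        S.b<ξ 0<y , S.ξ<1+b ,
        subst (λ M → (value (a ∷ as) -ᴷ natᴷ a) *ᴷ fixedPoint y M ≡ 1ᴷ) (sym (⟦∷ʳ⟧ as a)) S.inverse
        where
        module S = Step {δ} y (balanced (All.map proj₁ as≤m)) (proj₁ a≤m)
                        (trans (sym (disc-rotate a ⟦ as ⟧)) norm)

      -- The complete quotients are the larger fixed points of the successive rotations, and as many
      -- rotations as there are digits restore the word.
      periodicCF : ∀ {as} → Admissible as → PeriodicCFBoundedBy m (value as)
      periodicCF {as} h =
        (λ n → digit (rotations n as)) ,
        record
          { ξ       = λ n → value (rotations n as)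
          ; ξ-zero  = refl
          ; floor-≤ = λ n → inj₁ (proj₁ (steps n))
          ; floor-< = λ n → proj₁ (proj₂ (steps n))
          ; ξ-suc   = λ n → trans
              (cong (λ bs → (value (rotations n as) -ᴷ natᴷ (digit (rotations n as))) *ᴷ value bs) (rotations-suc n as))
              (proj₂ (proj₂ (steps n)))
          } ,
        (length as , nonEmpty h , λ n → cong digit (trans (rotations-+ (length as) n as)
                                                          (cong (rotations n) (rotations-length as)))) ,
        λ n → digit-bounded (rotations-admissible n h)
        where
        steps = λ n → first-step (rotations-admissible n h)
        nonEmpty : ∀ {as} → Admissible as → ℕ.NonZero (length as)
        nonEmpty (admissible _ _) = _

-- The folded period meets Pell's equation

module Folded where

  open Expansion

  disc-trace : ∀ M → disc M ≡ + trace M ℤ.* + trace M ℤ.- + 4 ℤ.* det M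
  disc-trace (mat A B C D) = identity (+ A) (+ B) (+ C) (+ D)
    where
    identity : ∀ x y z w → (x ℤ.- w) ℤ.* (x ℤ.- w) ℤ.+ + 4 ℤ.* (y ℤ.* z)
               ≡ (x ℤ.+ w) ℤ.* (x ℤ.+ w) ℤ.- + 4 ℤ.* (x ℤ.* w ℤ.- y ℤ.* z)
    identity = ℤ-Solver.solve-∀

  module _ {δ : ℕ} (s : PellSolution δ) where

    4qv : ℕ
    4qv = 4 ℕ.* (q s ℕ.* v s)

    0<4qv : + 0 ℤ.< + 4qv
    0<4qv = ℤ.+<+ (ℕ.<-≤-trans (ℕ.*-mono-< (0<q s) (0<v s)) (ℕ.m≤m+n (q s ℕ.* v s) _))

    -- With trace t, the discriminant is (t + 2) (t - 2). The first factor is 4 q², and Pell's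
    -- equation makes the second 4 q² - 4 = 4 δ v².
    disc-folded : ∀ {M} → FoldedMatrix (q s) M → disc M ≡ + δ ℤ.* (+ 4qv ℤ.* + 4qv)
    disc-folded {M} folded = begin
      disc M                                                     ≡⟨ disc-trace M ⟩
      t ℤ.* t ℤ.- + 4 ℤ.* det M                                  ≡⟨ cong (λ i → t ℤ.* t ℤ.- + 4 ℤ.* i) det≡ ⟩
      t ℤ.* t ℤ.- + 4                                            ≡⟨ difference t ⟩
      (t ℤ.+ + 2) ℤ.* (t ℤ.+ + 2 ℤ.- + 4)                        ≡⟨ cong (λ i → i ℤ.* (i ℤ.- + 4)) (cong +_ trace≡) ⟩
      + (4 ℕ.* (q s ℕ.* q s)) ℤ.* (+ (4 ℕ.* (q s ℕ.* q s)) ℤ.- + 4)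
        ≡⟨ cong₂ (λ i j → i ℤ.* (j ℤ.- + 4)) (ℤ.pos-* 4 (q s ℕ.* q s))
                 (trans (ℤ.pos-* 4 (q s ℕ.* q s)) (cong (λ k → + 4 ℤ.* + k) (pell s))) ⟩
      (+ 4 ℤ.* + (q s ℕ.* q s)) ℤ.* (+ 4 ℤ.* (+ 1 ℤ.+ + (δ ℕ.* (v s ℕ.* v s))) ℤ.- + 4)
        ≡⟨ cong₂ (λ i j → (+ 4 ℤ.* i) ℤ.* (+ 4 ℤ.* (+ 1 ℤ.+ j) ℤ.- + 4)) (ℤ.pos-* (q s) (q s))
                 (trans (ℤ.pos-* δ (v s ℕ.* v s)) (cong (+ δ ℤ.*_) (ℤ.pos-* (v s) (v s)))) ⟩
      (+ 4 ℤ.* (+ q s ℤ.* + q s)) ℤ.* (+ 4 ℤ.* (+ 1 ℤ.+ + δ ℤ.* (+ v s ℤ.* + v s)) ℤ.- + 4)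
        ≡⟨ collect (+ δ) (+ q s) (+ v s) ⟩
      + δ ℤ.* ((+ 4 ℤ.* (+ q s ℤ.* + v s)) ℤ.* (+ 4 ℤ.* (+ q s ℤ.* + v s)))
        ≡⟨ cong (λ i → + δ ℤ.* (i ℤ.* i)) (trans (ℤ.pos-* 4 (q s ℕ.* v s)) (cong (+ 4 ℤ.*_) (ℤ.pos-* (q s) (v s)))) ⟨
      + δ ℤ.* (+ 4qv ℤ.* + 4qv) ∎
      where
      open ≡-Reasoning
      open FoldedMatrix folded
      t : ℤ
      t = + trace M
      difference : ∀ t → t ℤ.* t ℤ.- + 4 ≡ (t ℤ.+ + 2) ℤ.* (t ℤ.+ + 2 ℤ.- + 4)
      difference = ℤ-Solver.solve-∀
      collect : ∀ d q v → (+ 4 ℤ.* (q ℤ.* q)) ℤ.* (+ 4 ℤ.* (+ 1 ℤ.+ d ℤ.* (v ℤ.* v)) ℤ.- + 4)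
                ≡ d ℤ.* ((+ 4 ℤ.* (q ℤ.* v)) ℤ.* (+ 4 ℤ.* (q ℤ.* v)))
      collect = ℤ-Solver.solve-∀

    im-folded : ∀ {M} → FoldedMatrix (q s) M →
                im (fixedPoint {δ} (+ 4qv) M) ℚ.* ι (+ q s) ≡ ι (+ v s)
    im-folded {M} folded = begin
      ι (+ 4qv) ℚ.* recip n ℚ.* ι (+ q s)         ≡⟨ swap (ι (+ 4qv)) (recip n) (ι (+ q s)) ⟩
      ι (+ 4qv) ℚ.* ι (+ q s) ℚ.* recip n         ≡⟨ cong (ℚ._* recip n) (ι-* (+ 4qv) (+ q s)) ⟨
      ι (+ 4qv ℤ.* + q s) ℚ.* recip n             ≡⟨ cong (λ i → ι i ℚ.* recip n) numerator ⟩
      ι (+ n ℤ.* + v s) ℚ.* recip n               ≡⟨ fromℕ-/ {δ} (v s) 0<n ⟨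
      ι (+ v s)                                   ∎
      where
      open ≡-Reasoning
      open FoldedMatrix folded
      open ℚ-Solver.+-*-Solver
      n : ℕ
      n = 2 ℕ.* C M
      swap : ∀ x y z → x ℚ.* y ℚ.* z ≡ x ℚ.* z ℚ.* y
      swap = solve 3 (λ x y z → x :* y :* z := x :* z :* y) refl
      n≡ : n ≡ 2 ℕ.* (2 ℕ.* (q s ℕ.* q s))
      n≡ = cong (2 ℕ.*_) C≡
      0<n : 0 ℕ.< n
      0<n = subst (0 ℕ.<_) (sym n≡) (ℕ.*-mono-< {0} {2} {0} (s≤s z≤n) (ℕ.*-mono-< {0} {2} {0} (s≤s z≤n) (ℕ.*-mono-< (0<q s) (0<q s))))
      identity : ∀ q v → 4 ℕ.* (q ℕ.* v) ℕ.* q ≡ 2 ℕ.* (2 ℕ.* (q ℕ.* q)) ℕ.* v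
      identity = ℕ-Solver.solve-∀
      numerator : + 4qv ℤ.* + q s ≡ + n ℤ.* + v s
      numerator = trans (sym (ℤ.pos-* 4qv (q s)))
        (trans (cong +_ (trans (identity (q s) (v s)) (cong (ℕ._* v s) (sym n≡)))) (ℤ.pos-* n (v s)))

  square-injective : ∀ {m n} → m ℕ.* m ≡ n ℕ.* n → m ≡ n
  square-injective {m} {n} eq with ℕ.<-cmp m n
  ... | tri< m<n _ _ = contradiction eq (ℕ.<⇒≢ (ℕ.*-mono-< m<n m<n))
  ... | tri≈ _ m≡n _ = m≡n
  ... | tri> _ _ n<m = contradiction (sym eq) (ℕ.<⇒≢ (ℕ.*-mono-< n<m n<m))

  -- With k the common value of the two products, adding δ k² to the square of either q gives the
  -- product of both squares.
  pell-ratio-injective : ∀ {δ} (s t : PellSolution δ) → v s ℕ.* q t ≡ v t ℕ.* q s → q s ≡ q t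
  pell-ratio-injective {δ} s t eq = square-injective (ℕ.+-cancelʳ-≡ (δ ℕ.* (k ℕ.* k)) _ _ (begin
    q s ℕ.* q s ℕ.+ δ ℕ.* (k ℕ.* k)                               ≡⟨ cong (λ k → q s ℕ.* q s ℕ.+ δ ℕ.* (k ℕ.* k)) eq ⟩
    q s ℕ.* q s ℕ.+ δ ℕ.* ((v t ℕ.* q s) ℕ.* (v t ℕ.* q s))       ≡⟨ identity (q s) (v t) δ ⟩
    q s ℕ.* q s ℕ.* (1 ℕ.+ δ ℕ.* (v t ℕ.* v t))                   ≡⟨ cong (q s ℕ.* q s ℕ.*_) (pell t) ⟨
    q s ℕ.* q s ℕ.* (q t ℕ.* q t)                                 ≡⟨ ℕ.*-comm (q s ℕ.* q s) (q t ℕ.* q t) ⟩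
    q t ℕ.* q t ℕ.* (q s ℕ.* q s)                                 ≡⟨ cong (q t ℕ.* q t ℕ.*_) (pell s) ⟩
    q t ℕ.* q t ℕ.* (1 ℕ.+ δ ℕ.* (v s ℕ.* v s))                   ≡⟨ identity (q t) (v s) δ ⟨
    q t ℕ.* q t ℕ.+ δ ℕ.* (k ℕ.* k)                               ∎))
    where
    open ≡-Reasoning
    k : ℕ
    k = v s ℕ.* q t
    identity : ∀ q v δ → q ℕ.* q ℕ.+ δ ℕ.* ((v ℕ.* q) ℕ.* (v ℕ.* q)) ≡ q ℕ.* q ℕ.* (1 ℕ.+ δ ℕ.* (v ℕ.* v))
    identity = ℕ-Solver.solve-∀

  im-determines-q : ∀ {δ} (s t : PellSolution δ) {M N} → FoldedMatrix (q s) M → FoldedMatrix (q t) N →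
    fixedPoint {δ} (+ 4qv s) M ≡ fixedPoint (+ 4qv t) N → q s ≡ q t
  im-determines-q {δ} s t {M} {N} foldedM foldedN eq = pell-ratio-injective s t (ℤ.+-injective (begin
    + (v s ℕ.* q t)      ≡⟨ ℤ.pos-* (v s) (q t) ⟩
    + v s ℤ.* + q t      ≡⟨ ι-injective cross ⟩
    + v t ℤ.* + q s      ≡⟨ ℤ.pos-* (v t) (q s) ⟨
    + (v t ℕ.* q s)      ∎))
    where
    open ≡-Reasoning
    open ℚ-Solver.+-*-Solver
    x y : ℚ
    x = im (fixedPoint {δ} (+ 4qv s) M)
    y = im (fixedPoint {δ} (+ 4qv t) N)
    swap : ∀ x y z → x ℚ.* y ℚ.* z ≡ x ℚ.* z ℚ.* y
    swap = solve 3 (λ x y z → x :* y :* z := x :* z :* y) refl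
    cross : ι (+ v s ℤ.* + q t) ≡ ι (+ v t ℤ.* + q s)
    cross = begin
      ι (+ v s ℤ.* + q t)               ≡⟨ ι-* (+ v s) (+ q t) ⟩
      ι (+ v s) ℚ.* ι (+ q t)           ≡⟨ cong (ℚ._* ι (+ q t)) (im-folded s foldedM) ⟨
      x ℚ.* ι (+ q s) ℚ.* ι (+ q t)     ≡⟨ swap x (ι (+ q s)) (ι (+ q t)) ⟩
      x ℚ.* ι (+ q t) ℚ.* ι (+ q s)     ≡⟨ cong (λ z → z ℚ.* ι (+ q t) ℚ.* ι (+ q s)) (cong im eq) ⟩
      y ℚ.* ι (+ q t) ℚ.* ι (+ q s)     ≡⟨ cong (ℚ._* ι (+ q s)) (im-folded t foldedN) ⟩
      ι (+ v t) ℚ.* ι (+ q s)           ≡⟨ ι-* (+ v t) (+ q s) ⟨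
      ι (+ v t ℤ.* + q s)               ∎

-- Assembly: a bounded period for every large Pell solution

open Expansion
open Folded

mainTheorem3 : ZarembaConjecture →
  ∃[ m′ ] ∀ (δ : ℕ) → NonSquare δ →
  InfinitelyMany {ℚ[√ δ ]} (PeriodicCFBoundedBy m′)
mainTheorem3 (m , zaremba) = suc m , λ δ δ-nonSquare → infinitelyMany δ δ-nonSquare (pellSolution δ-nonSquare)
  where
  period : ∀ n .{{_ : ℕ.NonZero n}} → m ℕ.+ 2 ℕ.< n →
    ∃[ bs ] All (Between1And (suc m)) bs × FoldedMatrix n ⟦ 1 ∷ bs ⟧
  period n large =
    let p , coprime , as , p/n≡ , as≤m = zaremba n
        bs , bs≤m , bs≡n = continuant≡denominator {p = p} coprime p/n≡ as≤m
        cs , cs≤m , folded = foldedPeriod bs≤m (subst (m ℕ.+ 2 ℕ.<_) (sym bs≡n) large)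
    in cs , cs≤m , subst (λ n → FoldedMatrix n ⟦ 1 ∷ cs ⟧) bs≡n folded
    where open Zaremba

  infinitelyMany : ∀ δ → NonSquare δ → PellSolution δ →
    InfinitelyMany {ℚ[√ δ ]} (PeriodicCFBoundedBy (suc m))
  infinitelyMany δ δ-nonSquare fundamental = ξ , ξ-injective , λ n →
    periodicCF (+ 4qv (s n)) (0<4qv (s n))
      (admissible (1-between ∷ proj₁ (proj₂ (word n))) (disc-folded (s n) (proj₂ (proj₂ (word n)))))
    where
    open Powers (0<δ δ-nonSquare) fundamental
    -- The shift by m + 2 skips the small solutions, so that every q exceeds the threshold m + 2
    -- needed to enlarge the end digits.
    s : ℕ → PellSolution δ
    s n = power (n ℕ.+ (m ℕ.+ 2))
    word : ∀ n → ∃[ bs ] All (Between1And (suc m)) bs × FoldedMatrix (q (s n)) ⟦ 1 ∷ bs ⟧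
    word n = period (q (s n)) {{ℕ.>-nonZero (0<q (s n))}}
      (ℕ.≤-<-trans (ℕ.m≤n+m (m ℕ.+ 2) n) (q-large (n ℕ.+ (m ℕ.+ 2))))
    ξ : ℕ → ℚ[√ δ ]
    ξ n = fixedPoint (+ 4qv (s n)) ⟦ 1 ∷ proj₁ (word n) ⟧
    ξ-injective : ∀ {i j} → ξ i ≡ ξ j → i ≡ j
    ξ-injective {i} {j} eq = ℕ.+-cancelʳ-≡ (m ℕ.+ 2) i j (q-injective
      (im-determines-q (s i) (s j) (proj₂ (proj₂ (word i))) (proj₂ (proj₂ (word j))) eq))
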